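{- For every natural number $m$, the fast Goodstein sequence starting on $m$ terminates in finite time; that is, there is $i<\omega$ with $g^m_i=0$.
   Context: Ordinals: $\varepsilon_0$ is the least ordinal $\varepsilon$ with $\omega^\varepsilon=\varepsilon$. Every $0<\xi<\varepsilon_0$ has a unique $\omega$-normal form $\xi=\omega^{\alpha}b+\gamma$ with $\alpha<\xi$, $b$ a positive natural number and $\gamma<\omega^\alpha$. Coefficients: $\mathrm{coeffs}(0)=\{0\}$, $\mathrm{coeffs}(\omega^\alpha b+\gamma)=\mathrm{coeffs}(\alpha)\cup\mathrm{coeffs}(\gamma)\cup\{b\}$ (in normal form), and $\mathrm{mc}(\xi)=\max\mathrm{coeffs}(\xi)$. Fundamental sequences $\xi[n]$ ($\xi<\varepsilon_0$, $n\in\mathbb N$), by recursion on $\omega$-normal forms: $0[n]=1[n]=0$; $(\omega^\alpha b+\gamma)[n]=\omega^\alpha b+\gamma[n]$ if $\gamma>0$; $\omega^{\alpha+1}[n]=\omega^\alpha n$; $(\omega^\alpha(b+1))[n]=\omega^\alpha b+(\omega^\alpha)[n]$ if $b>0$; $(\omega^\alpha)[n]=\omega^{\alpha[n]}$ if $\alpha$ is a limit. Functions $\mathbb A_k$ ($2\le k<\omega$), $\mathbb A_k:\varepsilon_0\to\mathbb N$ by transfinite recursion: if $\xi<\omega$, $\mathbb A_k(\xi)=\xi+1$. If $\xi\ge\omega$, write $\xi=\alpha+b$ with $\alpha$ a limit and $b<\omega$; set $\mathbb A_k^{(0)}(\xi)=\mathbb A_k(\xi-1)$ if $b>0$ and $\mathbb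 A_k^{(0)}(\xi)=\mathrm{mc}(\xi)$ if $b=0$; $\mathbb A_k^{(i+1)}(\xi)=\mathbb A_k(\alpha[\mathbb A_k^{(i)}(\xi)])$; and $\mathbb A_k(\xi)=\mathbb A_k^{(k)}(\xi)$. $\Omega$ denotes the first uncountable ordinal and $\varepsilon_{\Omega+1}$ the least $\varepsilon>\Omega$ with $\omega^\varepsilon=\varepsilon$. Each $0<\xi<\varepsilon_{\Omega+1}$ has a unique $\Omega$-normal form $\xi=\Omega^\alpha\beta+\gamma$ with $0<\beta<\Omega$, $\gamma<\Omega^\alpha$; $\mathrm{coeffs}_\Omega(0)=\{0\}$, $\mathrm{coeffs}_\Omega(\Omega^\alpha\beta+\gamma)=\mathrm{coeffs}_\Omega(\alpha)\cup\mathrm{coeffs}_\Omega(\gamma)\cup\{\beta\}$, $\mathrm{mc}_\Omega(\xi)=\max\mathrm{coeffs}_\Omega(\xi)$. $\mathbb A_\omega:\varepsilon_{\Omega+1}\to\Omega$ is defined recursively: $\mathbb A_\omega(\xi)$ is the least ordinal $\theta>\mathrm{mc}_\Omega(\xi)$ such that $\mathbb A_\omega(\zeta)<\theta$ for all $\zeta<\xi$ with $\mathrm{mc}_\Omega(\zeta)<\theta$. $k$-normal forms ($2\le k<\omega$): for a positive integer $m$ and $\xi<\varepsilon_0$, $\mathbb A_k(\xi)$ is the $k$-normal form of $m$ (written $m\equiv_k\mathbb A_k(\xi)$) if $m=\mathbb A_k(\xi)$ and there is a sequence $\xi_0,\dots,\xi_n<\varepsilon_0$ with $\xi_0=0$,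 $\xi_n=\xi$, and for each $i<n$, $\xi_{i+1}$ is the maximum $\zeta<\varepsilon_0$ with $\mathbb A_k(\zeta)\le m$ and $\mathrm{mc}(\zeta)\ge\mathbb A_k(\xi_i)$ if such a maximum exists, and $\xi_{i+1}=0$ otherwise. The paper takes for granted that each positive integer has exactly one $k$-normal form. Base change: for $2\le k<\lambda\le\omega$, let $\kappa=\omega$ if $\lambda<\omega$ and $\kappa=\Omega$ if $\lambda=\omega$. Define $x\mapsto x^{\uparrow\lambda}_k$ on natural numbers and ordinals below $\varepsilon_0$ by simultaneous recursion: $0^{\uparrow\lambda}_k=0$; if $m>0$ has $k$-normal form $\mathbb A_k(\xi)$ then $m^{\uparrow\lambda}_k=\mathbb A_\lambda(\xi^{\uparrow\lambda}_k)$; if $\xi=\omega^\alpha b+\gamma$ in $\omega$-normal form then $\xi^{\uparrow\lambda}_k=\kappa^{\alpha^{\uparrow\lambda}_k}\cdot b^{\uparrow\lambda}_k+\gamma^{\uparrow\lambda}_k$. Fast Goodstein sequence starting on $m$: $g^m_0=m$; if $g^m_i>0$ then $g^m_{i+1}=(g^m_i)^{\uparrow (i+3)}_{i+2}-1$; if $g^m_i=0$ the sequence stops. -}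

module Defs where

open import Data.Nat using (ℕ; zero; suc; _+_; _∸_; _≤_; _<_; _⊔_)
open import Data.Product using (_×_; _,_; ∃; Σ)
open import Data.Sum using (_⊎_)
open import Data.Unit using (⊤)
open import Data.Empty using (⊥)
open import Relation.Nullary using (¬_)
open import Relation.Binary.PropositionalEquality using (_≡_; _≢_)
open import Relation.Binary.Construct.Closure.ReflexiveTransitive using (Star)

-- Ordinals below ε₀ as Cantor (ω-)normal form terms.
-- cnf α b γ  represents  ω^α · b + γ.

data Ord : Set where
  𝟎   : Ord
  cnf : Ord → ℕ → Ord → Ord

data Cmp : Set where
  lt eq gt : Cmp

cmpℕ : ℕ → ℕ → Cmp
cmpℕ zero    zero    = eq
cmpℕ zero    (suc _) = lt
cmpℕ (suc _) zero    = gt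
cmpℕ (suc m) (suc n) = cmpℕ m n

cmp : Ord → Ord → Cmp
cmp 𝟎 𝟎 = eq
cmp 𝟎 (cnf _ _ _) = lt
cmp (cnf _ _ _) 𝟎 = gt
cmp (cnf a b c) (cnf a' b' c') with cmp a a'
... | lt = lt
... | gt = gt
... | eq with cmpℕ b b'
...   | lt = lt
...   | gt = gt
...   | eq = cmp c c'

_<ₒ_ : Ord → Ord → Set
a <ₒ b = cmp a b ≡ lt

_≤ₒ_ : Ord → Ord → Set
a ≤ₒ b = (cmp a b ≡ lt) ⊎ (cmp a b ≡ eq)

_<ω^_ : Ord → Ord → Set
𝟎 <ω^ a = ⊤
cnf a' _ _ <ω^ a = a' <ₒ a

data NF : Ord → Set where
  nf𝟎   : NF 𝟎
  nfcnf : ∀ {a b c} → NF a → NF c → 0 < b → c <ω^ a → NF (cnf a b c)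

mc : Ord → ℕ
mc 𝟎 = 0
mc (cnf a b c) = mc a ⊔ (mc c ⊔ b)

fin : ℕ → Ord
fin zero = 𝟎
fin (suc n) = cnf 𝟎 (suc n) 𝟎

isZero : Ord → Set
isZero 𝟎 = ⊤
isZero (cnf _ _ _) = ⊥

split : Ord → Ord × ℕ
split 𝟎 = 𝟎 , 0
split (cnf 𝟎 b 𝟎) = 𝟎 , b
split (cnf (cnf a₁ b₁ c₁) b 𝟎) = cnf (cnf a₁ b₁ c₁) b 𝟎 , 0
split (cnf a b (cnf a' b' c')) with split (cnf a' b' c')
... | α , k = cnf a b α , k

-- α + n  (α zero or a limit)
addFin : Ord → ℕ → Ord
addFin 𝟎 n = fin n
addFin (cnf a b c) n = cnf a b (addFin c n)

-- ordinal sum  ω^a · b + γ  renormalised (γ in normal form)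
plusTerm : Ord → ℕ → Ord → Ord
plusTerm a zero γ = γ
plusTerm a (suc b) 𝟎 = cnf a (suc b) 𝟎
plusTerm a (suc b) (cnf a' b' c') with cmp a a'
... | lt = cnf a' b' c'
... | eq = cnf a (suc b + b') c'
... | gt = cnf a (suc b) (cnf a' b' c')

mutual
  ωfs : Ord → ℕ → Ord
  ωfs a n with split a
  ... | 𝟎 , zero = 𝟎
  ... | α , suc k with n
  ...   | zero = 𝟎
  ...   | suc n' = cnf (addFin α k) (suc n') 𝟎
  ωfs a n | cnf _ _ _ , zero = cnf (fs a n) 1 𝟎

  fs : Ord → ℕ → Ord
  fs 𝟎 n = 𝟎
  fs (cnf a b (cnf a' b' c')) n = cnf a b (fs (cnf a' b' c') n)
  fs (cnf a zero 𝟎) n = 𝟎                 -- not a normal form; irrelevant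
  fs (cnf a (suc zero) 𝟎) n = ωfs a n
  fs (cnf a (suc (suc b)) 𝟎) n = cnf a (suc b) (ωfs a n)

-- The functions 𝔸_k, given by the graph of their transfinite recursion:
-- A k ξ m  means  𝔸_k(ξ) = m.

mutual
  data A (k : ℕ) : Ord → ℕ → Set where
    A-fin : ∀ {ξ j} → split ξ ≡ (𝟎 , j) → A k ξ (suc j)
    A-lim : ∀ {ξ α b v₀ w} → split ξ ≡ (α , b) → ¬ isZero α →
            A0 k α b v₀ → Iter k α k v₀ w → A k ξ w

  data A0 (k : ℕ) : Ord → ℕ → ℕ → Set where
    A0-suc  : ∀ {α b v} → A k (addFin α b) v → A0 k α (suc b) v
    A0-zero : ∀ {α} → A0 k α zero (mc α)

  -- Iter k α i v₀ w : starting from 𝔸^{(0)} = v₀, 𝔸^{(i)} = w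
  data Iter (k : ℕ) (α : Ord) : ℕ → ℕ → ℕ → Set where
    it-zero : ∀ {v} → Iter k α zero v v
    it-suc  : ∀ {i v u w} → Iter k α i v u → A k (fs α u) w → Iter k α (suc i) v w

Cand : ℕ → ℕ → Ord → Ord → Set
Cand k m ξ ζ = NF ζ × (∃ λ v → A k ζ v × v ≤ m) × (∃ λ u → A k ξ u × u ≤ mc ζ)

IsMax : ℕ → ℕ → Ord → Ord → Set
IsMax k m ξ ζ = Cand k m ξ ζ × (∀ ζ' → Cand k m ξ ζ' → ζ' ≤ₒ ζ)

data Next (k m : ℕ) (ξ : Ord) : Ord → Set where
  next-max  : ∀ {ζ} → IsMax k m ξ ζ → Next k m ξ ζ
  next-none : ¬ (∃ λ ζ → IsMax k m ξ ζ) → Next k m ξ 𝟎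

KNF : ℕ → ℕ → Ord → Set
KNF k m ξ = NF ξ × A k ξ m × Star (Next k m) 𝟎 ξ

-- Base change k ↦ λ (λ finite, so κ = ω); graph of the simultaneous recursion

mutual
  data UpN (k l : ℕ) : ℕ → ℕ → Set where
    upN-zero : UpN k l 0 0
    upN-suc  : ∀ {m ξ ξ' m'} → KNF k (suc m) ξ → UpO k l ξ ξ' → A l ξ' m' →
               UpN k l (suc m) m'

  data UpO (k l : ℕ) : Ord → Ord → Set where
    upO-zero : UpO k l 𝟎 𝟎
    upO-cnf  : ∀ {a b c a' b' c'} → UpO k l a a' → UpN k l b b' → UpO k l c c' →
               UpO k l (cnf a b c) (plusTerm a' b' c')

-- Fast Goodstein sequence:  Goodstein m i n  means  g^m_i = n

data Goodstein (m : ℕ) : ℕ → ℕ → Set where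
  g-zero : Goodstein m 0 m
  g-suc  : ∀ {i n u} → Goodstein m i (suc n) → UpN (i + 2) (i + 3) (suc n) u →
           Goodstein m (suc i) (u ∸ 1)

{-# OPTIONS --safe #-}
module Submission where

-- Let f be the base change from base k to base k + 1 and Φ its action on ordinals. By one
-- induction on m, f is strictly increasing and carries normal forms to normal forms. For
-- the latter, let 𝔸_k(ξ) be a normal form and suppose that ζ > Φ ξ, that 𝔸_{k+1}(ζ) is at
-- most 𝔸_{k+1}(Φ ξ), and that mc(Φ ξ) would stay below 𝔸(ζ) under every further base
-- change. Write ζ = β + b with β a limit, and let β[w] be the last ordinal visited by the
-- recursion for 𝔸_{k+1}(ζ), so that 𝔸_{k+1}(β[w]) = 𝔸_{k+1}(ζ). Then β[w] has the same
-- properties as ζ, which is an infinite descent: either no value of Φ lies between β[w]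
-- and β, or β is the supremum of the values of Φ below some limit α, and then the
-- iterations along α at base k, one fewer per unit than those along β at base k + 1, are
-- dominated by the latter, while ξ lies below the last ordinal visited along α.
--
-- For termination no notation system for ε_{Ω+1} is needed: the pairs (k, m) are compared
-- after iterated base change. If the numbers below m are accessible, then so are the
-- ordinals whose coefficients are accessible (as in the usual proof for ε₀), and m is
-- accessible because 𝔸(ζ) < 𝔸(ξ), both normal forms, implies ζ < ξ or 𝔸(ζ) ≤ mc(ξ).

open import Defs
open import Data.Nat
open import Data.Nat.Properties
open import Data.Nat.Induction using (<-wellFounded)
open import Data.Nat.Solver using (module +-*-Solver)
open import Data.Product using (_×_; _,_; ∃; proj₁; proj₂)
open import Data.Sum using (_⊎_; inj₁; inj₂)
open import Data.Empty using (⊥; ⊥-elim)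
open import Data.Unit using (tt)
open import Induction.WellFounded using (Acc; acc)
open import Relation.Binary.Construct.Closure.ReflexiveTransitive using (Star; ε; _◅_; _◅◅_)
open import Relation.Binary.Definitions using (tri<; tri≈; tri>)
open import Relation.Binary.PropositionalEquality
open import Relation.Nullary using (¬_; Dec; yes; no)

variable
  a a' c c' e x y α β η ξ ζ : Ord
  b b' i j m n t u v w z : ℕ

-- The order on Cantor normal form terms

infix 4 _≺_ _≼_ _◂_

data _≺_ : Ord → Ord → Set where
  ≺𝟎 : 𝟎 ≺ cnf a b c
  ≺e : a ≺ a' → cnf a b c ≺ cnf a' b' c'
  ≺n : b < b' → cnf a b c ≺ cnf a b' c'
  ≺t : c ≺ c' → cnf a b c ≺ cnf a b c'

_≼_ : Ord → Ord → Set
x ≼ y = x ≺ y ⊎ x ≡ y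

≺-irrefl : ¬ (x ≺ x)
≺-irrefl (≺e p) = ≺-irrefl p
≺-irrefl (≺n p) = <-irrefl refl p
≺-irrefl (≺t p) = ≺-irrefl p

≺-trans : ∀ {x y z} → x ≺ y → y ≺ z → x ≺ z
≺-trans ≺𝟎 (≺e q) = ≺𝟎
≺-trans ≺𝟎 (≺n q) = ≺𝟎
≺-trans ≺𝟎 (≺t q) = ≺𝟎
≺-trans (≺e p) (≺e q) = ≺e (≺-trans p q)
≺-trans (≺e p) (≺n q) = ≺e p
≺-trans (≺e p) (≺t q) = ≺e p
≺-trans (≺n p) (≺e q) = ≺e q
≺-trans (≺n p) (≺n q) = ≺n (<-trans p q)
≺-trans (≺n p) (≺t q) = ≺n p
≺-trans (≺t p) (≺e q) = ≺e q
≺-trans (≺t p) (≺n q) = ≺n q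
≺-trans (≺t p) (≺t q) = ≺t (≺-trans p q)

≼-≺-trans : ∀ {x y z} → x ≼ y → y ≺ z → x ≺ z
≼-≺-trans (inj₁ p) q = ≺-trans p q
≼-≺-trans (inj₂ refl) q = q

≺-≼-trans : ∀ {x y z} → x ≺ y → y ≼ z → x ≺ z
≺-≼-trans p (inj₁ q) = ≺-trans p q
≺-≼-trans p (inj₂ refl) = p

≼-trans : ∀ {x y z} → x ≼ y → y ≼ z → x ≼ z
≼-trans p (inj₁ q) = inj₁ (≼-≺-trans p q)
≼-trans p (inj₂ refl) = p

≺⇒⋡ : x ≺ y → ¬ (y ≼ x)
≺⇒⋡ p q = ≺-irrefl (≺-≼-trans p q)

≼-antisym : x ≼ y → y ≼ x → x ≡ y
≼-antisym (inj₂ p) q = p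
≼-antisym (inj₁ p) q = ⊥-elim (≺⇒⋡ p q)

data Tri (x y : Ord) : Set where
  tri≺ : x ≺ y → Tri x y
  tri≡ : x ≡ y → Tri x y
  tri≻ : y ≺ x → Tri x y

tri : ∀ x y → Tri x y
tri 𝟎 𝟎 = tri≡ refl
tri 𝟎 (cnf _ _ _) = tri≺ ≺𝟎
tri (cnf _ _ _) 𝟎 = tri≻ ≺𝟎
tri (cnf a b c) (cnf a' b' c') with tri a a'
... | tri≺ p = tri≺ (≺e p)
... | tri≻ p = tri≻ (≺e p)
... | tri≡ refl with <-cmp b b'
...   | tri< p _ _ = tri≺ (≺n p)
...   | tri> _ _ p = tri≻ (≺n p)
...   | tri≈ _ refl _ with tri c c'
...     | tri≺ p = tri≺ (≺t p)
...     | tri≻ p = tri≻ (≺t p)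
...     | tri≡ refl = tri≡ refl

≼-or-≻ : ∀ x y → x ≼ y ⊎ y ≺ x
≼-or-≻ x y with tri x y
... | tri≺ p = inj₁ (inj₁ p)
... | tri≡ p = inj₁ (inj₂ p)
... | tri≻ p = inj₂ p

𝟎≼ : ∀ x → 𝟎 ≼ x
𝟎≼ 𝟎 = inj₂ refl
𝟎≼ (cnf _ _ _) = inj₁ ≺𝟎

cmpℕ-refl : ∀ n → cmpℕ n n ≡ eq
cmpℕ-refl zero = refl
cmpℕ-refl (suc n) = cmpℕ-refl n

cmpℕ-< : m < n → cmpℕ m n ≡ lt
cmpℕ-< {zero} {suc n} _ = refl
cmpℕ-< {suc m} {suc n} (s≤s p) = cmpℕ-< p

cmpℕ-> : n < m → cmpℕ m n ≡ gt
cmpℕ-> {zero} {suc m} _ = refl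
cmpℕ-> {suc n} {suc m} (s≤s p) = cmpℕ-> p

cmp-refl : ∀ x → cmp x x ≡ eq
cmp-refl 𝟎 = refl
cmp-refl (cnf a b c) rewrite cmp-refl a | cmpℕ-refl b = cmp-refl c

≺⇒lt : x ≺ y → cmp x y ≡ lt
≺⇒lt ≺𝟎 = refl
≺⇒lt (≺e p) rewrite ≺⇒lt p = refl
≺⇒lt (≺n {a = a} p) rewrite cmp-refl a | cmpℕ-< p = refl
≺⇒lt (≺t {a = a} {b = b} p) rewrite cmp-refl a | cmpℕ-refl b = ≺⇒lt p

≺⇒gt : x ≺ y → cmp y x ≡ gt
≺⇒gt ≺𝟎 = refl
≺⇒gt (≺e p) rewrite ≺⇒gt p = refl
≺⇒gt (≺n {a = a} p) rewrite cmp-refl a | cmpℕ-> p = refl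
≺⇒gt (≺t {a = a} {b = b} p) rewrite cmp-refl a | cmpℕ-refl b = ≺⇒gt p

lt⇒≺ : cmp x y ≡ lt → x ≺ y
lt⇒≺ {x} {y} p with tri x y
... | tri≺ q = q
... | tri≡ refl with () ← trans (sym p) (cmp-refl x)
... | tri≻ q with () ← trans (sym p) (≺⇒gt q)

≼⇒≤ₒ : x ≼ y → x ≤ₒ y
≼⇒≤ₒ (inj₁ p) = inj₁ (≺⇒lt p)
≼⇒≤ₒ {x} (inj₂ refl) = inj₂ (cmp-refl x)

-- x ◂ e  means  x < ω^e.
data _◂_ : Ord → Ord → Set where
  ◂𝟎 : 𝟎 ◂ e
  ◂c : a ≺ e → cnf a b c ◂ e

data Nf : Ord → Set where
  nf0 : Nf 𝟎
  nfc : Nf a → Nf c → c ◂ a → Nf (cnf a (suc b) c)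

Nf⇒NF : Nf x → NF x
Nf⇒NF nf0 = nf𝟎
Nf⇒NF (nfc p q ◂𝟎) = nfcnf (Nf⇒NF p) nf𝟎 (s≤s z≤n) tt
Nf⇒NF (nfc p q (◂c r)) = nfcnf (Nf⇒NF p) (Nf⇒NF q) (s≤s z≤n) (≺⇒lt r)

NF⇒Nf : NF x → Nf x
NF⇒Nf nf𝟎 = nf0
NF⇒Nf (nfcnf p nf𝟎 (s≤s _) r) = nfc (NF⇒Nf p) nf0 ◂𝟎
NF⇒Nf (nfcnf p q@(nfcnf _ _ _ _) (s≤s _) r) = nfc (NF⇒Nf p) (NF⇒Nf q) (◂c (lt⇒≺ r))

◂⇒≺ : x ◂ e → x ≺ cnf e b c
◂⇒≺ ◂𝟎 = ≺𝟎
◂⇒≺ (◂c p) = ≺e p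

≺⇒◂ : Nf x → x ≺ cnf e 1 𝟎 → x ◂ e
≺⇒◂ nf0 p = ◂𝟎
≺⇒◂ (nfc _ _ _) (≺e p) = ◂c p
≺⇒◂ (nfc _ _ _) (≺n (s≤s ()))

-- Well-foundedness below ε₀

infix 4 _⊏_
-- Normality of the smaller side is built in because `≺` on raw terms is not well founded: as terms,
-- ω > 1 + ω > 1 + (1 + ω) > ....
_⊏_ : Ord → Ord → Set
x ⊏ y = Nf x × x ≺ y

-- Lexicographic descent on exponent, coefficient and tail. When the exponent drops, the new tail is
-- unrelated to the old one; it is reached through its own leading exponent, which lies below the
-- new exponent (`acc-◂`).
acc-cnf : Acc _⊏_ a → Acc _<_ b → Acc _⊏_ c → Acc _⊏_ (cnf a b c)
acc-below-cnf : Acc _⊏_ a → Acc _<_ b → Acc _⊏_ c → x ⊏ cnf a b c → Acc _⊏_ x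
acc-◂ : Acc _⊏_ a → Nf x → x ◂ a → Acc _⊏_ x

acc-cnf A B C = acc λ p → acc-below-cnf A B C p

acc-below-cnf A B C (_ , ≺𝟎) = acc λ { (_ , ()) }
acc-below-cnf (acc r) B C (nfc p q s , ≺e l) =
  acc-cnf (r (p , l)) (<-wellFounded _) (acc-◂ (r (p , l)) q s)
acc-below-cnf A (acc r) C (nfc p q s , ≺n l) = acc-cnf A (r l) (acc-◂ A q s)
acc-below-cnf A B (acc r) (nfc p q s , ≺t l) = acc-cnf A B (r (q , l))

acc-◂ A nf0 _ = acc λ { (_ , ()) }
acc-◂ (acc r) (nfc p q s) (◂c l) = acc-cnf (r (p , l)) (<-wellFounded _) (acc-◂ (r (p , l)) q s)

Nf⇒Acc : Nf x → Acc _⊏_ x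
Nf⇒Acc nf0 = acc λ { (_ , ()) }
Nf⇒Acc (nfc p q s) = acc-cnf (Nf⇒Acc p) (<-wellFounded _) (Nf⇒Acc q)

-- Limits, successors and the decomposition α + n

data LZ : Ord → Set
data Lim : Ord → Set
data Pos : Ord → Set

-- LZ: zero or a limit; Pos: nonzero.
data LZ where
  lz : LZ 𝟎
  ll : Lim α → LZ α

data Lim where
  lc : Lim c → Lim (cnf a (suc b) c)
  lb : Pos e → Lim (cnf e (suc b) 𝟎)

data Pos where
  ps : LZ α → e ≡ addFin α (suc z) → Pos e
  pl : Lim e → Pos e

addFin-0 : ∀ α → addFin α 0 ≡ α
addFin-0 𝟎 = refl
addFin-0 (cnf a b c) = cong (cnf a b) (addFin-0 c)

addFin-≺ : ∀ α → m < n → addFin α m ≺ addFin α n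
addFin-≺ {zero} {suc n} 𝟎 _ = ≺𝟎
addFin-≺ {suc m} {suc n} 𝟎 p = ≺n p
addFin-≺ (cnf a b c) p = ≺t (addFin-≺ c p)

≼-addFin : ∀ α b → α ≼ addFin α b
≼-addFin α zero = inj₂ (sym (addFin-0 α))
≼-addFin α (suc b) = inj₁ (subst (_≺ addFin α (suc b)) (addFin-0 α) (addFin-≺ {0} α (s≤s z≤n)))

Pos-nonzero : Pos e → 𝟎 ≺ e
Pos-nonzero (ps lz refl) = ≺𝟎
Pos-nonzero (ps (ll (lc _)) refl) = ≺𝟎
Pos-nonzero (ps (ll (lb _)) refl) = ≺𝟎
Pos-nonzero (pl (lc _)) = ≺𝟎
Pos-nonzero (pl (lb _)) = ≺𝟎

Lim-nonzero : Lim α → 𝟎 ≺ α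
Lim-nonzero (lc _) = ≺𝟎
Lim-nonzero (lb _) = ≺𝟎

fin-Nf : ∀ n → Nf (fin n)
fin-Nf zero = nf0
fin-Nf (suc n) = nfc nf0 nf0 ◂𝟎

fin-◂ : ∀ n → 𝟎 ≺ e → fin n ◂ e
fin-◂ zero p = ◂𝟎
fin-◂ (suc n) p = ◂c p

addFin-◂ : α ◂ e → 𝟎 ≺ e → addFin α n ◂ e
addFin-◂ {n = n} ◂𝟎 q = fin-◂ n q
addFin-◂ (◂c p) q = ◂c p

addFin-◂⁻ : addFin α n ◂ e → α ◂ e
addFin-◂⁻ {𝟎} p = ◂𝟎
addFin-◂⁻ {cnf _ _ _} (◂c p) = ◂c p

addFin-Nf : LZ α → Nf α → ∀ n → Nf (addFin α n)
addFin-Nf lz _ n = fin-Nf n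
addFin-Nf (ll (lc l)) (nfc p q r) n =
  nfc p (addFin-Nf (ll l) q n) (addFin-◂ r (exp-pos l r))
  where
  exp-pos : Lim c → c ◂ a → 𝟎 ≺ a
  exp-pos (lc _) (◂c {𝟎} q) = q
  exp-pos (lc _) (◂c {cnf _ _ _} q) = ≺-trans ≺𝟎 q
  exp-pos (lb _) (◂c {𝟎} q) = q
  exp-pos (lb _) (◂c {cnf _ _ _} q) = ≺-trans ≺𝟎 q
addFin-Nf (ll (lb l)) (nfc p q r) n = nfc p (fin-Nf n) (fin-◂ n (Pos-nonzero l))

data View : Ord → Set where
  view : LZ α → Nf α → ∀ b → View (addFin α b)

View⇒Pos : View (cnf a b c) → Pos (cnf a b c)
View⇒Pos v = go v refl where
  go : View x → x ≡ cnf a b c → Pos (cnf a b c)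
  go (view l _ (suc z)) p = ps l (sym p)
  go (view {α = 𝟎} lz _ zero) ()
  go (view {α = α} (ll l) _ zero) p = pl (subst Lim (trans (sym (addFin-0 α)) p) l)

toView : Nf x → View x
toView nf0 = view lz nf0 0
toView (nfc {a = 𝟎} {b = b} p nf0 ◂𝟎) = view lz nf0 (suc b)
toView (nfc {a = 𝟎} p q (◂c ()))
toView (nfc {a = a@(cnf _ _ _)} p q r) = go (toView q) r (View⇒Pos (toView p))
  where
  go : View c → c ◂ a → Pos a → View (cnf a (suc b) c)
  go (view lz _ z) r pa = view (ll (lb pa)) (nfc p nf0 ◂𝟎) z
  go (view (ll l) n z) r pa = view (ll (lc l)) (nfc p n (addFin-◂⁻ r)) z

split-cons : ∀ a b → 𝟎 ≺ x → split (cnf a b x) ≡ (cnf a b (proj₁ (split x)) , proj₂ (split x))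
split-cons 𝟎 b (≺𝟎 {a'} {b'} {c'}) with split (cnf a' b' c')
... | _ , _ = refl
split-cons (cnf _ _ _) b (≺𝟎 {a'} {b'} {c'}) with split (cnf a' b' c')
... | _ , _ = refl

split-addFin : LZ α → ∀ n → split (addFin α n) ≡ (α , n)
split-addFin lz zero = refl
split-addFin lz (suc n) = refl
split-addFin (ll (lb {e = 𝟎} p)) _ = ⊥-elim (≺-irrefl (Pos-nonzero p))
split-addFin (ll (lb {e = cnf _ _ _} p)) zero = refl
split-addFin (ll (lb {e = cnf _ _ _} p)) (suc n) = refl
split-addFin (ll (lc {c = c} {a = a} {b = b} l)) n =
  trans (split-cons a (suc b) (≺-≼-trans (Lim-nonzero l) (≼-addFin c n)))
        (cong (λ s → cnf a (suc b) (proj₁ s) , proj₂ s) (split-addFin (ll l) n))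

addFin-injective : LZ α → LZ β → addFin α m ≡ addFin β n → α ≡ β × m ≡ n
addFin-injective {m = m} {n = n} l l' p with trans (sym (split-addFin l m)) (trans (cong split p) (split-addFin l' n))
... | refl = refl , refl

≺-addFin-suc : Nf x → LZ α → x ≺ addFin α (suc n) → x ≼ addFin α n
≺-addFin-suc {n = zero} nf0 lz p = inj₂ refl
≺-addFin-suc {n = suc n} nf0 lz p = inj₁ ≺𝟎
≺-addFin-suc {n = zero} (nfc _ _ _) lz (≺n (s≤s ()))
≺-addFin-suc {n = suc n} (nfc _ _ r) lz (≺n {b = suc b} (s≤s p)) with m≤n⇒m<n∨m≡n p
... | inj₁ q = inj₁ (≺n q)
... | inj₂ refl with r
...   | ◂𝟎 = inj₂ refl
≺-addFin-suc _ (ll (lc l)) ≺𝟎 = inj₁ ≺𝟎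
≺-addFin-suc _ (ll (lc l)) (≺e p) = inj₁ (≺e p)
≺-addFin-suc _ (ll (lc l)) (≺n p) = inj₁ (≺n p)
≺-addFin-suc (nfc _ q _) (ll (lc l)) (≺t p) with ≺-addFin-suc q (ll l) p
... | inj₁ r = inj₁ (≺t r)
... | inj₂ refl = inj₂ refl
≺-addFin-suc _ (ll (lb l)) ≺𝟎 = inj₁ ≺𝟎
≺-addFin-suc _ (ll (lb l)) (≺e p) = inj₁ (≺e p)
≺-addFin-suc _ (ll (lb l)) (≺n p) = inj₁ (≺n p)
≺-addFin-suc (nfc _ q _) (ll (lb l)) (≺t p) with ≺-addFin-suc q lz p
... | inj₁ r = inj₁ (≺t r)
... | inj₂ refl = inj₂ refl

≺-addFin⇒ : Nf x → LZ α → α ≼ x → x ≺ addFin α n → ∃ λ m → m < n × x ≡ addFin α m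
≺-addFin⇒ {α = α} {n = zero} q l p r = ⊥-elim (≺⇒⋡ (subst (_ ≺_) (addFin-0 α) r) p)
≺-addFin⇒ {n = suc n} q l p r with ≺-addFin-suc q l r
... | inj₂ refl = n , ≤-refl , refl
... | inj₁ s with ≺-addFin⇒ q l p s
...   | m , m<n , r' = m , m≤n⇒m≤1+n m<n , r'

mc-addFin : ∀ α n → mc (addFin α n) ≡ mc α ⊔ n
mc-addFin 𝟎 zero = refl
mc-addFin 𝟎 (suc n) = refl
mc-addFin (cnf a b c) n = begin
  mc a ⊔ (mc (addFin c n) ⊔ b)  ≡⟨ cong (λ s → mc a ⊔ (s ⊔ b)) (mc-addFin c n) ⟩
  mc a ⊔ ((mc c ⊔ n) ⊔ b)       ≡⟨ cong (mc a ⊔_) (⊔-assoc (mc c) n b) ⟩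
  mc a ⊔ (mc c ⊔ (n ⊔ b))       ≡⟨ cong (λ s → mc a ⊔ (mc c ⊔ s)) (⊔-comm n b) ⟩
  mc a ⊔ (mc c ⊔ (b ⊔ n))       ≡⟨ cong (mc a ⊔_) (sym (⊔-assoc (mc c) b n)) ⟩
  mc a ⊔ ((mc c ⊔ b) ⊔ n)       ≡⟨ sym (⊔-assoc (mc a) (mc c ⊔ b) n) ⟩
  mc a ⊔ (mc c ⊔ b) ⊔ n         ∎
  where open ≡-Reasoning

-- Fundamental sequences

-- ω^e·b + x with the head dropped when b = 0; for x = ω^e[n] this is (ω^e·(b+1))[n].
pre : Ord → ℕ → Ord → Ord
pre e zero x = x
pre e (suc b) x = cnf e (suc b) x

fs-lc : Lim c → ∀ a b n → fs (cnf a b c) n ≡ cnf a b (fs c n)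
fs-lc (lc _) a b n = refl
fs-lc (lb _) a b n = refl

fs-lb : ∀ e b n → fs (cnf e (suc b) 𝟎) n ≡ pre e b (ωfs e n)
fs-lb e zero n = refl
fs-lb e (suc b) n = refl

ωfs-s : LZ α → 0 < n → ωfs (addFin α (suc z)) n ≡ cnf (addFin α z) n 𝟎
ωfs-s {α = α} {z = z} l (s≤s p) with split (addFin α (suc z)) | split-addFin l (suc z)
ωfs-s lz (s≤s p) | _ | refl = refl
ωfs-s (ll (lc _)) (s≤s p) | _ | refl = refl
ωfs-s (ll (lb _)) (s≤s p) | _ | refl = refl

ωfs-l : Lim e → ∀ n → ωfs e n ≡ cnf (fs e n) 1 𝟎
ωfs-l {e} l n with split e | trans (cong split (sym (addFin-0 e))) (split-addFin (ll l) 0)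
ωfs-l (lc _) n | _ | refl = refl
ωfs-l (lb _) n | _ | refl = refl

pos-nf : 0 < b → Nf a → Nf c → c ◂ a → Nf (cnf a b c)
pos-nf (s≤s _) = nfc

pos-of-nf : Nf (cnf a b c) → 0 < b
pos-of-nf (nfc _ _ _) = s≤s z≤n

exp-Nf : Nf (cnf a b c) → Nf a
exp-Nf (nfc p _ _) = p

tail-Nf : Nf (cnf a b c) → Nf c
tail-Nf (nfc _ q _) = q

tail-◂ : Nf (cnf a b c) → c ◂ a
tail-◂ (nfc _ _ r) = r

pre-Nf : Nf e → Nf x → x ◂ e → ∀ b → Nf (pre e b x)
pre-Nf p q r zero = q
pre-Nf p q r (suc b) = nfc p q r

pre-≺ : x ◂ e → ∀ b → pre e b x ≺ cnf e (suc b) 𝟎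
pre-≺ r zero = ◂⇒≺ r
pre-≺ r (suc b) = ≺n ≤-refl

mc-pre : ∀ e x b → mc x ≤ mc (pre e b x)
mc-pre e x zero = ≤-refl
mc-pre e x (suc b) = ≤-trans (m≤m⊔n (mc x) (suc b)) (m≤n⊔m (mc e) _)

mc-exp : ∀ a b c → mc a ≤ mc (cnf a b c)
mc-exp a b c = m≤m⊔n (mc a) _

mc-coef : ∀ a b c → b ≤ mc (cnf a b c)
mc-coef a b c = ≤-trans (m≤n⊔m (mc c) b) (m≤n⊔m (mc a) _)

mc-tail : ∀ a b c → mc c ≤ mc (cnf a b c)
mc-tail a b c = ≤-trans (m≤m⊔n (mc c) b) (m≤n⊔m (mc a) _)

fs-≺ : Lim α → 0 < n → fs α n ≺ α
ωfs-◂ : Pos e → 0 < n → ωfs e n ◂ e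

fs-≺ {n = n} (lc {a = a} {b = b} l) p rewrite fs-lc l a (suc b) n = ≺t (fs-≺ l p)
fs-≺ {n = n} (lb {e} {b} q) p rewrite fs-lb e b n = pre-≺ (ωfs-◂ q p) b
ωfs-◂ (ps {α} {z = z} l refl) p rewrite ωfs-s {z = z} l p = ◂c (addFin-≺ α ≤-refl)
ωfs-◂ {n = n} (pl l) p rewrite ωfs-l l n = ◂c (fs-≺ l p)

Pos-pred-Nf : LZ α → Nf (addFin α (suc z)) → Nf α
Pos-pred-Nf lz _ = nf0
Pos-pred-Nf (ll (lc l)) (nfc p q r) = nfc p (Pos-pred-Nf (ll l) q) (addFin-◂⁻ r)
Pos-pred-Nf (ll (lb l)) (nfc p q r) = nfc p nf0 ◂𝟎

fs-Nf : Lim α → Nf α → 0 < n → Nf (fs α n)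
ωfs-Nf : Pos e → Nf e → 0 < n → Nf (ωfs e n)

fs-Nf {n = n} (lc {a = a} {b = b} l) (nfc p q r) s rewrite fs-lc l a (suc b) n =
  nfc p (fs-Nf l q s) (fs-◂ l r)
  where
  fs-◂ : Lim c → c ◂ a → fs c n ◂ a
  fs-◂ l r = lead (≺-trans (fs-≺ l s) (◂⇒≺ r))
    where
    lead : x ≺ cnf e 0 𝟎 → x ◂ e
    lead ≺𝟎 = ◂𝟎
    lead (≺e p) = ◂c p
fs-Nf {n = n} (lb {e} {b} l) (nfc p q r) s rewrite fs-lb e b n = pre-Nf p (ωfs-Nf l p s) (ωfs-◂ l s) b
ωfs-Nf (ps {z = z} l refl) p s rewrite ωfs-s {z = z} l s =
  pos-nf s (addFin-Nf l (Pos-pred-Nf l p) z) nf0 ◂𝟎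
ωfs-Nf {n = n} (pl l) p s rewrite ωfs-l l n = nfc (fs-Nf l p s) nf0 ◂𝟎

-- The recursion for α[n] ends at a successor exponent, where ω^(δ+1)[n] = ω^δ·n makes n a
-- coefficient.
≤-mc-fs : Lim α → 0 < n → n ≤ mc (fs α n)
≤-mc-ωfs : Pos e → 0 < n → n ≤ mc (ωfs e n)

≤-mc-fs {n = n} (lc {c} {a} {b} l) s rewrite fs-lc l a (suc b) n =
  ≤-trans (≤-mc-fs l s) (mc-tail a (suc b) (fs c n))
≤-mc-fs {n = n} (lb {e} {b} l) s rewrite fs-lb e b n = ≤-trans (≤-mc-ωfs l s) (mc-pre e (ωfs e n) b)
≤-mc-ωfs {n = n} (ps {α} {z = z} l refl) s rewrite ωfs-s {z = z} l s = mc-coef (addFin α z) n 𝟎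
≤-mc-ωfs {n = n} (pl {e} l) s rewrite ωfs-l l n = ≤-trans (≤-mc-fs l s) (mc-exp (fs e n) 1 𝟎)

≺-pre : Nf x → x ≺ cnf e (suc b) 𝟎 → (∀ {y} → Nf y → y ◂ e → mc y ≤ mc x → y ≺ ζ) → x ≺ pre e b ζ
≺-pre {b = zero} nx p f = f nx (≺⇒◂ nx p) ≤-refl
≺-pre {b = suc b} nx ≺𝟎 f = ≺𝟎
≺-pre {b = suc b} nx (≺e p) f = ≺e p
≺-pre {b = suc b} (nfc {a} {c} {b = b'} p q r) (≺n (s≤s l)) f with m≤n⇒m<n∨m≡n l
... | inj₁ s = ≺n s
... | inj₂ refl = ≺t (f q r (mc-tail a (suc b) c))

-- The bound on mc η is decisive at ω^(δ+1): there the leading exponent of η is at most δ, and if it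
-- equals δ the leading coefficient is at most mc η < n.
≺-fs : Lim α → Nf η → η ≺ α → mc η < n → η ≺ fs α n
≺-ωfs : Pos e → Nf η → η ◂ e → mc η < n → η ≺ ωfs e n

≺-fs {n = n} (lc {a = a} {b = b} l) nη p m rewrite fs-lc l a (suc b) n with nη | p
... | _ | ≺𝟎 = ≺𝟎
... | _ | ≺e q = ≺e q
... | _ | ≺n q = ≺n q
... | nfc {c = c} _ nc _ | ≺t q = ≺t (≺-fs l nc q (≤-<-trans (mc-tail a (suc b) c) m))
≺-fs {n = n} (lb {e} {b} l) nη p m rewrite fs-lb e b n =
  ≺-pre nη p (λ ny q r → ≺-ωfs l ny q (≤-<-trans r m))
≺-ωfs {n = n} (ps {α} {z = z} l refl) nη p m rewrite ωfs-s {z = z} l (≤-<-trans z≤n m) with nη | p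
... | _ | ◂𝟎 = ≺𝟎
... | nfc {a} {c} {b} na _ _ | ◂c q with ≺-addFin-suc na l q
...   | inj₁ r = ≺e r
...   | inj₂ refl = ≺n (≤-<-trans (mc-coef a (suc b) c) m)
≺-ωfs {n = n} (pl l) nη p m rewrite ωfs-l l n with nη | p
... | _ | ◂𝟎 = ≺𝟎
... | nfc {a} {c} {b} na _ _ | ◂c q = ≺e (≺-fs l na q (≤-<-trans (mc-exp a (suc b) c) m))

1≼ : 0 < b → cnf a 1 𝟎 ≼ cnf a b c
1≼ {suc zero} {c = 𝟎} _ = inj₂ refl
1≼ {suc zero} {c = cnf _ _ _} _ = inj₁ (≺t ≺𝟎)
1≼ {suc (suc b)} _ = inj₁ (≺n (s≤s (s≤s z≤n)))

≤⇒cnf≼ : b ≤ b' → cnf a b 𝟎 ≼ cnf a b' c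
≤⇒cnf≼ {c = c} p with m≤n⇒m<n∨m≡n p
... | inj₁ q = inj₁ (≺n q)
≤⇒cnf≼ {c = 𝟎} p | inj₂ refl = inj₂ refl
≤⇒cnf≼ {c = cnf _ _ _} p | inj₂ refl = inj₁ (≺t ≺𝟎)

-- This is the Bachmann property of fundamental sequences. It ensures that a descent from a point
-- between α[n] and α cannot jump over α[n], which is how `val-fs-≤` uses it.
bachmann : Lim α → Nf α → Lim η → Nf η → 0 < n → 0 < m →
           fs α n ≺ η → η ≺ α → fs α n ≼ fs η m
bachmann-ω : Pos e → Nf e → Lim η → Nf η → 0 < n → 0 < m →
             ωfs e n ≺ η → η ◂ e → ωfs e n ≼ fs η m

bachmann {n = n} (lc {a = a} {b = b} l) (nfc na nc _) lη nη 0<n 0<m p q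
  rewrite fs-lc l a (suc b) n with p | q
... | ≺e r | ≺e s = ⊥-elim (≺-irrefl (≺-trans r s))
... | ≺e r | ≺n s = ⊥-elim (≺-irrefl r)
... | ≺e r | ≺t s = ⊥-elim (≺-irrefl r)
... | ≺n r | ≺e s = ⊥-elim (≺-irrefl s)
... | ≺n r | ≺n s = ⊥-elim (<-asym r s)
... | ≺n r | ≺t s = ⊥-elim (<-irrefl refl r)
... | ≺t r | ≺e s = ⊥-elim (≺-irrefl s)
... | ≺t r | ≺n s = ⊥-elim (<-irrefl refl s)
bachmann {n = n} {m = m} (lc {a = a} {b = b} l) (nfc na nc _) (lc l') (nfc _ nc' _) 0<n 0<m p q
    | ≺t r | ≺t s rewrite fs-lc l' a (suc b) m with bachmann l nc l' nc' 0<n 0<m r s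
...   | inj₁ t = inj₁ (≺t t)
...   | inj₂ t = inj₂ (cong (cnf a (suc b)) t)
bachmann (lc l) _ (lb _) _ 0<n 0<m p q | ≺t () | ≺t s
bachmann {n = n} (lb {e} {zero} l) (nfc ne _ _) lη nη 0<n 0<m p q =
  bachmann-ω l ne lη nη 0<n 0<m p (≺⇒◂ nη q)
bachmann {n = n} {m = m} (lb {e} {suc b} l) (nfc ne _ _) lη nη 0<n 0<m p q with p | q
... | ≺e r | ≺e s = ⊥-elim (≺-irrefl (≺-trans r s))
... | ≺e r | ≺n s = ⊥-elim (≺-irrefl r)
... | ≺n r | ≺e s = ⊥-elim (≺-irrefl s)
... | ≺n r | ≺n s = ⊥-elim (<⇒≱ r (≤-pred s))
... | ≺t r | ≺e s = ⊥-elim (≺-irrefl s)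
bachmann {n = n} {m = m} (lb {e} {suc b} l) (nfc ne _ _) (lc l') (nfc _ nc r') 0<n 0<m p q | ≺t r | ≺n s
  rewrite fs-lc l' e (suc b) m with bachmann-ω l ne l' nc 0<n 0<m r r'
...   | inj₁ t = inj₁ (≺t t)
...   | inj₂ t = inj₂ (cong (cnf e (suc b)) t)
bachmann {n = n} {m = m} (lb {e} {suc b} l) (nfc ne _ _) (lb l') (nfc _ nc r') 0<n 0<m p q | ≺t () | ≺n s

bachmann-ω {n = n} {m = m} (ps {α} {z = z} l refl) ne lη nη 0<n 0<m p q
  rewrite ωfs-s {z = z} l 0<n with lη | nη | p | q
... | lc {a = a} {b = b} l' | _ | ≺e r | _ rewrite fs-lc l' a (suc b) m = inj₁ (≺e r)
... | lc {a = a} {b = b} l' | _ | ≺n r | _ rewrite fs-lc l' a (suc b) m = inj₁ (≺n r)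
... | lc {a = a} {b = b} l' | _ | ≺t r | _ rewrite fs-lc l' a (suc b) m = ≤⇒cnf≼ ≤-refl
... | lb l' | nfc na _ _ | ≺e r | ◂c s = ⊥-elim (≺⇒⋡ r (≺-addFin-suc na l s))
... | lb {e} {zero} l' | _ | ≺n r | _ = ⊥-elim (<⇒≱ r 0<n)
... | lb {e} {suc b} l' | _ | ≺n (s≤s r) | _ = ≤⇒cnf≼ r
... | lb l' | _ | ≺t () | _
bachmann-ω {n = n} {m = m} (pl l) ne lη nη 0<n 0<m p q
  rewrite ωfs-l l n with lη | nη | p | q
... | lc {a = a} {b = b} l' | _ | ≺e r | _ rewrite fs-lc l' a (suc b) m = inj₁ (≺e r)
... | lc {a = a} {b = b} l' | _ | ≺n r | _ rewrite fs-lc l' a (suc b) m = inj₁ (≺n r)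
... | lc {a = a} {b = b} l' | _ | ≺t r | _ rewrite fs-lc l' a (suc b) m = ≤⇒cnf≼ ≤-refl
... | lb {a} {suc b} l' | _ | ≺e r | _ = inj₁ (≺e r)
... | lb {a} {suc b} l' | _ | ≺n r | _ = ≤⇒cnf≼ (s≤s z≤n)
... | lb {a} {zero} l' | _ | ≺n (s≤s ()) | _
... | lb l' | _ | ≺t () | _
... | lb {a} {zero} (ps {z = z'} l' refl) | nfc na _ _ | ≺e r | _ rewrite ωfs-s {z = z'} l' 0<m
  with ≺-addFin-suc (fs-Nf l ne 0<n) l' r
...   | inj₁ t = inj₁ (≺e t)
...   | inj₂ t rewrite t = ≤⇒cnf≼ 0<m
bachmann-ω {n = n} {m = m} (pl l) ne lη nη 0<n 0<m p q
    | lb {a} {zero} (pl l') | nfc na _ _ | ≺e r | ◂c s rewrite ωfs-l l' m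
  with bachmann l ne l' na 0<n 0<m r s
...   | inj₁ t = inj₁ (≺e t)
...   | inj₂ t rewrite t = inj₂ refl

-- The functions 𝔸_k

◂? : ∀ x e → Dec (x ◂ e)
◂? 𝟎 e = yes ◂𝟎
◂? (cnf a b c) e with tri a e
... | tri≺ p = yes (◂c p)
... | tri≡ refl = no λ { (◂c q) → ≺-irrefl q }
... | tri≻ p = no λ { (◂c q) → ≺-irrefl (≺-trans p q) }

Nf? : ∀ x → Dec (Nf x)
Nf? 𝟎 = yes nf0
Nf? (cnf a zero c) = no λ ()
Nf? (cnf a (suc b) c) with Nf? a | Nf? c | ◂? c a
... | yes p | yes q | yes r = yes (nfc p q r)
... | no ¬p | _ | _ = no λ s → ¬p (exp-Nf s)
... | _ | no ¬q | _ = no λ s → ¬q (tail-Nf s)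
... | _ | _ | no ¬r = no λ s → ¬r (tail-◂ s)

Lim-mc-pos : Lim α → 0 < mc α
Lim-mc-pos (lc {c} {a} {b} _) = ≤-trans (s≤s z≤n) (mc-coef a (suc b) c)
Lim-mc-pos (lb {a} {b} _) = ≤-trans (s≤s z≤n) (mc-coef a (suc b) 𝟎)

Lim-¬isZero : Lim α → ¬ isZero α
Lim-¬isZero (lc _) ()
Lim-¬isZero (lb _) ()

-- Bases are written κ + 2, which builds in k ≥ 2.
module Base (κ : ℕ) where

  k : ℕ
  k = suc (suc κ)

  A-det : A k ξ v → A k ξ w → v ≡ w
  A0-det : ∀ {r} → A0 k α b v → A0 k α b r → v ≡ r
  Iter-det : ∀ {r} → Iter k α i v w → Iter k α i v r → w ≡ r

  A-det (A-fin p) (A-fin q) with refl ← trans (sym p) q = refl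
  A-det (A-fin p) (A-lim q nz _ _) with refl ← trans (sym p) q = ⊥-elim (nz tt)
  A-det (A-lim q nz _ _) (A-fin p) with refl ← trans (sym p) q = ⊥-elim (nz tt)
  A-det (A-lim p _ s t) (A-lim q _ s' t') with refl ← trans (sym p) q with refl ← A0-det s s' = Iter-det t t'
  A0-det (A0-suc p) (A0-suc q) = A-det p q
  A0-det A0-zero A0-zero = refl
  Iter-det it-zero it-zero = refl
  Iter-det (it-suc p q) (it-suc p' q') with refl ← Iter-det p p' = A-det q q'

  -- The bound on mc ξ is carried along because, with `≤-mc-fs`, it makes every iterate exceed the
  -- previous one; this keeps the arguments of `fs` positive and gives the bound for the next
  -- ordinal.
  Value : Ord → Set
  Value ξ = ∃ λ v → A k ξ v × mc ξ < v

  iterate : (∀ u → 0 < u → ∃ λ v → A k (fs α u) v × u < v) →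
            ∀ i v → 0 < v → ∃ λ w → Iter k α i v w × v + i ≤ w
  iterate f zero v p = v , it-zero , ≤-reflexive (+-identityʳ v)
  iterate f (suc i) v p with iterate f i v p
  ... | u , I , v+i≤u with f u (≤-trans p (≤-trans (m≤m+n v i) v+i≤u))
  ...   | w , a , u<w = w , it-suc I a , ≤-trans (≤-reflexive (+-suc v i)) (≤-<-trans v+i≤u u<w)

  value : Acc _⊏_ ξ → Nf ξ → Value ξ
  value-view : Acc _⊏_ ξ → View ξ → Value ξ
  value-view _ (view lz _ b) = suc b , A-fin (split-addFin lz b) ,
    s≤s (≤-reflexive (mc-addFin 𝟎 b))
  value-view (acc r) (view {α} (ll l) n zero)
    with iterate (λ u 0<u → step u 0<u) k (mc α) (Lim-mc-pos l)
    where
    step : ∀ u → 0 < u → ∃ λ v → A k (fs α u) v × u < v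
    step u 0<u with value (r (fs-Nf l n 0<u , ≺-≼-trans (fs-≺ l 0<u) (≼-addFin α 0))) (fs-Nf l n 0<u)
    ... | v , a , p = v , a , ≤-<-trans (≤-mc-fs l 0<u) p
  ... | w , I , p = w , A-lim (split-addFin (ll l) 0) (Lim-¬isZero l) A0-zero I ,
    subst (λ x → mc x < w) (sym (addFin-0 α)) (≤-trans (subst (_≤ mc α + k) (+-comm (mc α) 1) (+-monoʳ-≤ (mc α) (s≤s z≤n))) p)
  value-view (acc r) (view {α} (ll l) n (suc b))
    with value (r (addFin-Nf (ll l) n b , addFin-≺ α ≤-refl)) (addFin-Nf (ll l) n b)
  ... | v , a , q
    with iterate (λ u 0<u → step u 0<u) k v (≤-trans (s≤s z≤n) q)
    where
    step : ∀ u → 0 < u → ∃ λ v → A k (fs α u) v × u < v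
    step u 0<u with value (r (fs-Nf l n 0<u , ≺-≼-trans (fs-≺ l 0<u) (≼-addFin α (suc b)))) (fs-Nf l n 0<u)
    ... | v , a , p = v , a , ≤-<-trans (≤-mc-fs l 0<u) p
  ... | w , I , p = w , A-lim (split-addFin (ll l) (suc b)) (Lim-¬isZero l) (A0-suc a) I ,
    (begin-strict
      mc (addFin α (suc b))    ≡⟨ mc-addFin α (suc b) ⟩
      mc α ⊔ suc b             ≤⟨ ⊔-lub (m≤n⇒m≤1+n (m≤m⊔n (mc α) b)) (s≤s (m≤n⊔m (mc α) b)) ⟩
      suc (mc α ⊔ b)           ≡⟨ cong suc (sym (mc-addFin α b)) ⟩
      suc (mc (addFin α b))    ≤⟨ q ⟩
      v                        <⟨ n<1+n v ⟩
      suc v                    ≡⟨ +-comm 1 v ⟩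
      v + 1                    ≤⟨ +-monoʳ-≤ v (s≤s z≤n) ⟩
      v + k                    ≤⟨ p ⟩
      w                        ∎)
    where open ≤-Reasoning
  value a n = value-view a (toView n)

  abstract
    -- 𝔸_k as a total function, with the dummy value 0 outside normal forms. It is abstract so that
    -- the well-founded recursion in `value` is never unfolded.
    val : Ord → ℕ
    val ξ with Nf? ξ
    ... | yes p = proj₁ (value (Nf⇒Acc p) p)
    ... | no _ = 0

    val-A : Nf ξ → A k ξ (val ξ)
    val-A {ξ} p with Nf? ξ
    ... | yes q = proj₁ (proj₂ (value (Nf⇒Acc q) q))
    ... | no ¬q = ⊥-elim (¬q p)

    mc<val : Nf ξ → mc ξ < val ξ
    mc<val {ξ} p with Nf? ξ
    ... | yes q = proj₂ (proj₂ (value (Nf⇒Acc q) q))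
    ... | no ¬q = ⊥-elim (¬q p)

  val-fin : ∀ j → val (addFin 𝟎 j) ≡ suc j
  val-fin j = A-det (val-A (addFin-Nf lz nf0 j)) (A-fin (split-addFin lz j))

  -- A single chain of iterates serves all α + b: the iteration for α + b + 1 starts at 𝔸(α + b),
  -- where the one for α + b ended. Hence 𝔸(α + b) is the entry of index (b+1)k.
  W : Ord → ℕ → ℕ
  W α zero = mc α
  W α (suc j) = val (fs α (W α j))

  W-pos : Lim α → Nf α → ∀ j → 0 < W α j
  W-pos l n zero = Lim-mc-pos l
  W-pos l n (suc j) = ≤-trans (s≤s z≤n) (mc<val (fs-Nf l n (W-pos l n j)))

  W-suc : Lim α → Nf α → ∀ j → W α j < W α (suc j)
  W-suc l n j = ≤-<-trans (≤-mc-fs l (W-pos l n j)) (mc<val (fs-Nf l n (W-pos l n j)))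

  W-mono : Lim α → Nf α → i ≤′ j → W α i ≤ W α j
  W-mono l n (≤′-reflexive refl) = ≤-refl
  W-mono l n (≤′-step {j} p) = ≤-trans (W-mono l n p) (<⇒≤ (W-suc l n j))

  W-mono-≤ : Lim α → Nf α → ∀ {i j} → i ≤ j → W α i ≤ W α j
  W-mono-≤ l n p = W-mono l n (≤⇒≤′ p)

  W-growth : Lim α → Nf α → ∀ j → mc α + j ≤ W α j
  W-growth l n zero = ≤-reflexive (+-identityʳ _)
  W-growth {α} l n (suc j) = ≤-trans (≤-reflexive (+-suc (mc α) j)) (≤-<-trans (W-growth l n j) (W-suc l n j))

  Iter-W : Lim α → Nf α → ∀ i j → Iter k α i (W α j) (W α (i + j))
  Iter-W l n zero j = it-zero
  Iter-W l n (suc i) j = it-suc (Iter-W l n i j) (val-A (fs-Nf l n (W-pos l n (i + j))))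

  A-W : Lim α → Nf α → ∀ b → A k (addFin α b) (W α (suc b * k))
  A-W l n zero = A-lim (split-addFin (ll l) 0) (Lim-¬isZero l) A0-zero (Iter-W l n k 0)
  A-W l n (suc b) = A-lim (split-addFin (ll l) (suc b)) (Lim-¬isZero l) (A0-suc (A-W l n b)) (Iter-W l n k (suc b * k))

  val-lim : Lim α → Nf α → ∀ b → val (addFin α b) ≡ W α (suc b * k)
  val-lim l n b = A-det (val-A (addFin-Nf (ll l) n b)) (A-W l n b)

  val-addFin-suc : LZ α → Nf α → ∀ b → val (addFin α b) < val (addFin α (suc b))
  val-addFin-suc lz _ b rewrite val-fin b | val-fin (suc b) = ≤-refl
  val-addFin-suc {α} (ll l) n b rewrite val-lim l n b | val-lim l n (suc b) =
    <-≤-trans (W-suc l n (suc b * k)) (W-mono-≤ l n (s≤s (m≤n+m (suc b * k) (suc κ))))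

  val-addFin-< : LZ α → Nf α → m < n → val (addFin α m) < val (addFin α n)
  val-addFin-< {α} {m} l p q = go (≤⇒≤′ q)
    where
    go : ∀ {n} → suc m ≤′ n → val (addFin α m) < val (addFin α n)
    go (≤′-reflexive refl) = val-addFin-suc l p m
    go (≤′-step {n} q) = <-trans (go q) (val-addFin-suc l p n)

  -- Descend from η to its predecessor, or, at a limit, to the last ordinal visited by its
  -- recursion, which has the same value. By `bachmann` the descent stays at or above α[n].
  val-fs-≤ : Lim α → Nf α → 0 < n → Nf η → fs α n ≼ η → η ≺ α → val (fs α n) ≤ val η
  val-fs-≤ {α} {n} l nα 0<n nη p q = go (Nf⇒Acc nη) nη p q
    where
    go : Acc _⊏_ η → Nf η → fs α n ≼ η → η ≺ α → val (fs α n) ≤ val η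
    go-view : Acc _⊏_ η → View η → fs α n ≺ η → η ≺ α → val (fs α n) ≤ val η
    go-view a (view lz _ zero) () q
    go-view (acc r) (view {β} l' n' (suc b)) p q =
      ≤-trans (go (r (addFin-Nf l' n' b , addFin-≺ β ≤-refl)) (addFin-Nf l' n' b)
                  (≺-addFin-suc (fs-Nf l nα 0<n) l' p) (≺-trans (addFin-≺ β ≤-refl) q))
              (<⇒≤ (val-addFin-suc l' n' b))
    go-view (acc r) (view {β} (ll l') n' zero) p q = begin
      val (fs α n)                  ≤⟨ go (r (nfs , ≺-≼-trans (fs-≺ l' wp) (≼-addFin β 0))) nfs
                                          (bachmann l nα l' n' 0<n wp (subst (fs α n ≺_) (addFin-0 β) p)
                                            (subst (_≺ α) (addFin-0 β) q))
                                          (≺-trans (fs-≺ l' wp) (subst (_≺ α) (addFin-0 β) q)) ⟩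
      W β k                         ≡⟨ cong (W β) (sym (+-identityʳ k)) ⟩
      W β (1 * k)                   ≡⟨ sym (val-lim l' n' 0) ⟩
      val (addFin β 0)              ∎
      where
      open ≤-Reasoning
      wp : 0 < W β (suc κ)
      wp = W-pos l' n' (suc κ)
      nfs : Nf (fs β (W β (suc κ)))
      nfs = fs-Nf l' n' wp
    go a nη (inj₂ refl) q = ≤-refl
    go a nη (inj₁ p) q = go-view a (toView nη) p q

-- Normal forms

ht : Ord → ℕ
ht 𝟎 = 0
ht (cnf a b c) = suc (ht a)

ht-addFin : Lim α → ∀ n → ht (addFin α n) ≡ ht α
ht-addFin (lc _) n = refl
ht-addFin (lb _) n = refl

ht-fs : Lim α → 0 < n → ht α ≤ suc (ht (fs α n))
ht-ωfs : Pos e → 0 < n → ht e ≤ ht (ωfs e n)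

ht-fs {n = n} (lc {a = a} {b = b} l) p rewrite fs-lc l a (suc b) n = n≤1+n _
ht-fs {n = n} (lb {e} {zero} q) p = s≤s (ht-ωfs q p)
ht-fs {n = n} (lb {e} {suc b} q) p = n≤1+n _
ht-ωfs (ps {z = z} lz refl) p rewrite ωfs-s {z = z} lz p = s≤s z≤n
ht-ωfs (ps {z = z} (ll l) refl) p rewrite ωfs-s {z = z} (ll l) p | ht-addFin l z | ht-addFin l (suc z) = n≤1+n _
ht-ωfs {n = n} (pl l) p rewrite ωfs-l l n = ht-fs l p

tower : ℕ → Ord
tower zero = cnf 𝟎 1 𝟎
tower (suc h) = cnf (tower h) 1 𝟎

tower-Nf : ∀ h → Nf (tower h)
tower-Nf zero = nfc nf0 nf0 ◂𝟎
tower-Nf (suc h) = nfc (tower-Nf h) nf0 ◂𝟎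

≺-tower : ∀ x {h} → ht x ≤ h → x ≺ tower h
≺-tower 𝟎 {zero} p = ≺𝟎
≺-tower 𝟎 {suc h} p = ≺𝟎
≺-tower (cnf a b c) (s≤s p) = ≺e (≺-tower a p)

≼∧≢⇒≺ : x ≼ y → x ≢ y → x ≺ y
≼∧≢⇒≺ (inj₁ p) _ = p
≼∧≢⇒≺ (inj₂ p) q = ⊥-elim (q p)

module NormalForm (κ : ℕ) where

  open Base κ public

  -- Passing from α to α[mc α] loses at most one level of exponents, and since k ≥ 2 at least one
  -- more iteration follows and makes up for it. This confines all candidates for m to ordinals
  -- below a fixed tower.
  ht≤val : Nf ξ → ht ξ ≤ val ξ
  ht≤val p = go (toView p) (Nf⇒Acc p)
    where
    go : View ξ → Acc _⊏_ ξ → ht ξ ≤ val ξ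
    go (view lz _ zero) _ = z≤n
    go (view lz _ (suc b)) _ rewrite val-fin (suc b) = s≤s z≤n
    go (view {α} (ll l) n b) (acc r) rewrite ht-addFin l b | val-lim l n b = begin
      ht α                       ≤⟨ ht-fs l (Lim-mc-pos l) ⟩
      suc (ht (fs α (mc α)))     ≤⟨ s≤s (go (toView nfs) (r (nfs , ≺-≼-trans (fs-≺ l (Lim-mc-pos l)) (≼-addFin α b)))) ⟩
      suc (W α 1)                ≤⟨ W-suc l n 1 ⟩
      W α 2                      ≤⟨ W-mono-≤ l n {2} {suc b * k} (s≤s (s≤s z≤n)) ⟩
      W α (suc b * k)            ∎
      where
      open ≤-Reasoning
      nfs : Nf (fs α (mc α))
      nfs = fs-Nf l n (Lim-mc-pos l)

  -- Existence and uniqueness of normal forms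

  Candidate : ℕ → ℕ → Ord → Set
  Candidate m v ζ = Nf ζ × val ζ ≤ m × v ≤ mc ζ

  Maximal : ℕ → ℕ → Ord → Set
  Maximal m v ζ = Candidate m v ζ × (∀ {ξ} → Candidate m v ξ → ξ ≼ ζ)

  Candidate? : ∀ m v ζ → Nf ζ → Dec (Candidate m v ζ)
  Candidate? m v ζ p with val ζ ≤? m | v ≤? mc ζ
  ... | yes q | yes r = yes (p , q , r)
  ... | no ¬q | _ = no λ { (_ , q , _) → ¬q q }
  ... | _ | no ¬r = no λ { (_ , _ , r) → ¬r r }

  -- Candidates ζ below a limit β satisfy mc ζ < val ζ ≤ m, hence lie below β[m+1].
  search : Acc _⊏_ β → Nf β → (∀ {ζ} → Candidate m v ζ → ζ ≺ β) →
           (∃ λ ζ → Maximal m v ζ) ⊎ (∀ {ζ} → ¬ Candidate m v ζ)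
  search-view : View β → Acc _⊏_ β → (∀ {ζ} → Candidate m v ζ → ζ ≺ β) →
           (∃ λ ζ → Maximal m v ζ) ⊎ (∀ {ζ} → ¬ Candidate m v ζ)
  search A p f = search-view (toView p) A f
  search-view (view lz _ zero) A f = inj₂ λ q → ≺⇒⋡ (f q) (𝟎≼ _)
  search-view {m = m} {v = v} (view {α} l n (suc b)) (acc r) f
    with Candidate? m v (addFin α b) (addFin-Nf l n b)
  ... | yes q = inj₁ (addFin α b , q , λ q' → ≺-addFin-suc (proj₁ q') l (f q'))
  ... | no ¬q = search (r (addFin-Nf l n b , addFin-≺ α ≤-refl)) (addFin-Nf l n b) λ q' →
        ≼∧≢⇒≺ (≺-addFin-suc (proj₁ q') l (f q')) λ { refl → ¬q q' }
  search-view {m = m} {v = v} (view {α} (ll l) n zero) (acc r) f =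
    search (r (fs-Nf l n (s≤s z≤n) , ≺-≼-trans (fs-≺ l (s≤s z≤n)) (≼-addFin α 0))) (fs-Nf l n (s≤s z≤n)) λ {ζ} q' →
      ≺-fs l (proj₁ q') (subst (ζ ≺_) (addFin-0 α) (f q')) (s≤s (≤-trans (<⇒≤ (mc<val (proj₁ q'))) (proj₁ (proj₂ q'))))

  -- The search starts at a tower bounding all candidates. It cannot come back empty, as the finite
  -- ordinal v is a candidate: 𝔸(v) = v + 1 ≤ m.
  maximal : v < m → ∃ λ ζ → Maximal m v ζ
  maximal {v} {m} p with search (Nf⇒Acc (tower-Nf m)) (tower-Nf m)
                              (λ {ζ} q → ≺-tower ζ (≤-trans (ht≤val (proj₁ q)) (proj₁ (proj₂ q))))
  ... | inj₁ q = q
  ... | inj₂ ¬q = ⊥-elim (¬q {addFin 𝟎 v} (addFin-Nf lz nf0 v , subst (_≤ m) (sym (val-fin v)) p ,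
                             subst (v ≤_) (sym (mc-addFin 𝟎 v)) ≤-refl))

  -- Ch m ξ: ξ is a term of the sequence ξ₀, ξ₁, … that defines the normal form of
  -- m, reached before that sequence returns to 0.
  data Ch (m : ℕ) : Ord → Set where
    c0 : 0 < m → Ch m 𝟎
    cs : Ch m ξ → val ξ < m → Maximal m (val ξ) ζ → Ch m ζ

  val-𝟎 : val 𝟎 ≡ 1
  val-𝟎 = val-fin 0

  Ch-Nf : Ch m ξ → Nf ξ
  Ch-Nf (c0 _) = nf0
  Ch-Nf (cs _ _ M) = proj₁ (proj₁ M)

  Ch-val : Ch m ξ → val ξ ≤ m
  Ch-val (c0 p) = subst (_≤ _) (sym val-𝟎) p
  Ch-val (cs _ _ M) = proj₁ (proj₂ (proj₁ M))

  Maximal-< : Maximal m v ζ → v < val ζ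
  Maximal-< ((p , _ , q) , _) = ≤-<-trans q (mc<val p)

  -- Lowering m to n only removes candidates, and the terms up to ξ themselves survive because
  -- values increase along the sequence; so each of them remains maximal.
  Ch-prefix : Ch m ξ → val ξ ≤ n → n ≤ m → Ch n ξ
  Ch-prefix (c0 _) p _ = c0 (subst (_≤ _) val-𝟎 p)
  Ch-prefix (cs ch q M@((nf , _ , r) , f)) p n≤m =
    cs (Ch-prefix ch (<⇒≤ (<-≤-trans (Maximal-< M) p)) n≤m) (<-≤-trans (Maximal-< M) p)
       ((nf , p , r) , λ { (nf' , p' , r') → f (nf' , ≤-trans p' n≤m , r') })

  Ch-exists : 0 < m → ∃ λ ξ → Ch m ξ × val ξ ≡ m
  Ch-exists {m} 0<m = go m (c0 0<m) (m≤n+m m _)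
    where
    -- d is fuel bounding m minus the current value, which grows at every term.
    go : ∀ d {ξ} → Ch m ξ → m ≤ val ξ + d → ∃ λ ζ → Ch m ζ × val ζ ≡ m
    go d {ξ} ch p with val ξ <? m
    ... | no ¬q = ξ , ch , ≤-antisym (Ch-val ch) (≮⇒≥ ¬q)
    go zero ch p | yes q = ⊥-elim (<⇒≱ q (≤-trans p (≤-reflexive (+-identityʳ _))))
    go (suc d) {ξ} ch p | yes q with maximal q
    ... | ζ , M = go d (cs ch q M) (≤-trans p (≤-trans (≤-reflexive (+-suc (val ξ) d)) (+-monoˡ-≤ d (Maximal-< M))))

  -- Compare each ordinal with the predecessor of the other. In the one case not settled at once,
  -- each is a candidate at the step where the other was chosen as maximum, so they coincide.
  Ch-linear : Ch m ξ → Ch m ζ → ξ ≡ ζ ⊎ val ξ ≤ mc ζ ⊎ val ζ ≤ mc ξ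
  Ch-linear (c0 _) (c0 _) = inj₁ refl
  Ch-linear (c0 _) (cs {ρ} ch _ ((_ , _ , r) , _)) =
    inj₂ (inj₁ (≤-trans (subst (_≤ val ρ) (sym val-𝟎) (≤-trans (s≤s z≤n) (mc<val (Ch-Nf ch)))) r))
  Ch-linear (cs {ρ} ch _ ((_ , _ , r) , _)) (c0 _) =
    inj₂ (inj₂ (≤-trans (subst (_≤ val ρ) (sym val-𝟎) (≤-trans (s≤s z≤n) (mc<val (Ch-Nf ch)))) r))
  Ch-linear X@(cs {ρ} ch _ M@(C@(nf , _ , r) , f)) Y@(cs {ρ'} ch' _ M'@(C'@(nf' , _ , r') , f'))
    with Ch-linear ch Y | Ch-linear X ch'
  ... | inj₁ refl | _ = inj₂ (inj₂ r)
  ... | inj₂ (inj₂ s) | _ = inj₂ (inj₂ (≤-trans s (<⇒≤ (<-≤-trans (mc<val (Ch-Nf ch)) r))))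
  ... | _ | inj₁ refl = inj₂ (inj₁ r')
  ... | _ | inj₂ (inj₁ s) = inj₂ (inj₁ (≤-trans s (<⇒≤ (<-≤-trans (mc<val (Ch-Nf ch')) r'))))
  ... | inj₂ (inj₁ s) | inj₂ (inj₂ s') =
    inj₁ (≼-antisym (f' (nf , proj₁ (proj₂ C) , s')) (f (nf' , proj₁ (proj₂ C') , s)))

  Ch-unique : Ch m ξ → val ξ ≡ m → Ch m ζ → val ζ ≡ m → ξ ≡ ζ
  Ch-unique p refl q r with Ch-linear p q
  ... | inj₁ s = s
  ... | inj₂ (inj₁ s) = ⊥-elim (<⇒≱ (mc<val (Ch-Nf q)) (≤-trans (≤-reflexive r) s))
  ... | inj₂ (inj₂ s) = ⊥-elim (<⇒≱ (mc<val (Ch-Nf p)) (≤-trans (≤-reflexive (sym r)) s))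

  𝟎≺⇒mc-pos : Nf ζ → 𝟎 ≺ ζ → 0 < mc ζ
  𝟎≺⇒mc-pos (nfc {a} {c} {b} _ _ _) _ = ≤-trans (s≤s z≤n) (mc-coef a (suc b) c)

  -- 𝔸(ξ) is a normal form.
  NFO : Ord → Set
  NFO ξ = Ch (val ξ) ξ

  Ch⇒NFO : Ch m ξ → NFO ξ
  Ch⇒NFO ch = Ch-prefix ch ≤-refl (Ch-val ch)

  -- Comparison of normal forms

  Skipped : ℕ → Ord → Ord → Ord → Set
  Skipped m ξ ζ ρ = Ch m ρ × ζ ≼ ρ × mc ζ < val ρ × val ρ ≤ mc ξ

  -- Walk back along the sequence. While the current term is below ζ, its maximality bars ζ as a
  -- candidate, so mc ζ is less than the preceding value. The walk ends at a term at or above ζ; it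
  -- cannot run past 0, as mc ζ ≥ 1 = 𝔸(0).
  skipped : Ch m ξ → val ξ ≡ m → Nf ζ → ξ ≺ ζ → val ζ ≤ m → ∃ (Skipped m ξ ζ)
  skipped {m} {ζ = ζ} (c0 p) refl nζ q r =
    ⊥-elim (<⇒≱ (≤-<-trans (𝟎≺⇒mc-pos nζ q) (mc<val nζ)) (≤-trans r (≤-reflexive val-𝟎)))
  skipped {m} {ζ = ζ} (cs ch s M) _ nζ q r = go ch M q
    where
    go : ∀ {ρ ξ} → Ch m ρ → Maximal m (val ρ) ξ → ξ ≺ ζ → ∃ (Skipped m ξ ζ)
    go {ρ} ch M@((_ , _ , t) , f) q with val ρ ≤? mc ζ
    ... | yes u = ⊥-elim (≺⇒⋡ q (f (nζ , r , u)))
    ... | no ¬u with ≼-or-≻ ζ ρ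
    ...   | inj₁ p = ρ , ch , p , ≰⇒> ¬u , t
    go (c0 _) M q | no ¬u | inj₂ p = ⊥-elim (¬u (subst (_≤ mc ζ) (sym val-𝟎) (𝟎≺⇒mc-pos nζ p)))
    go (cs ch' _ M') M@((_ , _ , t) , f) q | no ¬u | inj₂ p with go ch' M' p
    ... | σ , x , y , w , z = σ , x , y , w , ≤-trans z (<⇒≤ (<-≤-trans (mc<val (proj₁ (proj₁ M'))) t))

  -- Let ρ be the term given by `skipped`. If 𝔸(ρ) < 𝔸(ζ), then ρ also occurs in the sequence of
  -- 𝔸(ζ), and `Ch-linear` leaves only ρ = ζ.
  NFO-≻ : NFO ξ → NFO ζ → ξ ≺ ζ → val ζ ≤ val ξ → val ζ ≤ mc ξ
  NFO-≻ {ξ} {ζ} p q r s with skipped p refl (Ch-Nf q) r s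
  ... | ρ , ch , _ , t , u with val ζ ≤? val ρ
  ...   | yes w = ≤-trans w u
  ...   | no ¬w with Ch-linear (Ch-prefix ch (<⇒≤ (≰⇒> ¬w)) s) q
  ...     | inj₁ refl = u
  ...     | inj₂ (inj₁ x) = ⊥-elim (<⇒≱ t x)
  ...     | inj₂ (inj₂ x) = ⊥-elim (¬w (≤-trans x (<⇒≤ (mc<val (Ch-Nf ch)))))

  -- A converse of `NFO-≻`, obtained by comparing ξ with the true normal form of the number 𝔸(ξ).
  ≻⇒NFO : Nf ξ → (∀ {ζ} → NFO ζ → ξ ≺ ζ → val ζ ≤ val ξ → val ζ ≤ mc ξ) → NFO ξ
  ≻⇒NFO {ξ} nξ f with Ch-exists (≤-trans (s≤s z≤n) (mc<val nξ))
  ... | ζ , ch , p with tri ξ ζ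
  ...   | tri≡ refl = ch
  ...   | tri≺ q = ⊥-elim (<⇒≱ (mc<val nξ) (≤-trans (≤-reflexive (sym p)) (f (Ch⇒NFO ch) q (≤-reflexive p))))
  ...   | tri≻ q with skipped ch p nξ q ≤-refl
  ...     | ρ , ch' , inj₂ refl , r , s = ⊥-elim (<⇒≱ (mc<val (Ch-Nf ch)) (≤-trans (≤-reflexive p) s))
  ...     | ρ , ch' , inj₁ t , r , s = ⊥-elim (<⇒≱ r (f (Ch⇒NFO ch') t (Ch-val ch')))

  abstract
    nfo : ℕ → Ord
    -- A dummy value: 0 has no normal form.
    nfo zero = 𝟎
    nfo (suc m) = proj₁ (Ch-exists {suc m} (s≤s z≤n))

    nfo-Nf : ∀ m → Nf (nfo m)
    nfo-Nf zero = nf0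
    nfo-Nf (suc m) = Ch-Nf (proj₁ (proj₂ (Ch-exists {suc m} (s≤s z≤n))))

    nfo-Ch : 0 < m → Ch m (nfo m)
    nfo-Ch {suc m} _ = proj₁ (proj₂ (Ch-exists {suc m} (s≤s z≤n)))

    nfo-val : 0 < m → val (nfo m) ≡ m
    nfo-val {suc m} _ = proj₂ (proj₂ (Ch-exists {suc m} (s≤s z≤n)))

  nfo-NFO : 0 < m → NFO (nfo m)
  nfo-NFO p = Ch⇒NFO (nfo-Ch p)

  nfo-unique : NFO ξ → nfo (val ξ) ≡ ξ
  nfo-unique {ξ} p = Ch-unique (nfo-Ch q) (nfo-val q) p refl
    where
    q : 0 < val ξ
    q = ≤-trans (s≤s z≤n) (mc<val (Ch-Nf p))

  mc-nfo : 0 < m → mc (nfo m) < m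
  mc-nfo {m} p = subst (mc (nfo m) <_) (nfo-val p) (mc<val (nfo-Nf m))

  mc-nfo-< : ∀ m → mc (nfo (suc m)) < suc m
  mc-nfo-< m = mc-nfo (s≤s z≤n)

  -- For v = mc x this is the condition  t^{↑ω} < 𝔸_ω(x^{↑ω}),  unfolded along the
  -- maximal coefficients of t; unlike t < 𝔸(x), it does not depend on the base.
  data Sub (x : Ord) (v : ℕ) : ℕ → Set where
    stop : t ≤ v → Sub x v t
    step : nfo (suc t) ≺ x → Sub x v (mc (nfo (suc t))) → Sub x v (suc t)

  Sub-step : 0 < t → nfo t ≺ x → Sub x v (mc (nfo t)) → Sub x v t
  Sub-step (s≤s _) p s = step p s

  Sub-unfold : Sub x v t → t ≤ v ⊎ 0 < t × nfo t ≺ x × Sub x v (mc (nfo t))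
  Sub-unfold (stop p) = inj₁ p
  Sub-unfold (step p s) = inj₂ (s≤s z≤n , p , s)

  -- Outer induction on u, inner induction on the derivation for t. If the normal form of u is not
  -- below x, it is above that of t, and `NFO-≻` bounds u by the maximal coefficient of t, to which
  -- the inner induction applies.
  Sub-≤ : Sub x v t → u ≤ t → Sub x v u
  Sub-≤ {x} {v} {t} {u} s p = below (<-wellFounded u) s p
    where
    Below : ℕ → Set
    Below u = ∀ {t} → Sub x v t → u ≤ t → Sub x v u

    go : ∀ u → (∀ {u'} → u' < u → Below u') → Below u
    go u f (stop q) p = stop (≤-trans p q)
    go zero f _ p = stop z≤n
    go (suc u) f S@(step {t} q s) p with ≼-or-≻ x (nfo (suc u))
    ... | inj₂ l = step l (f (mc-nfo-< u) S (≤-trans (<⇒≤ (mc-nfo-< u)) p))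
    ... | inj₁ l = go (suc u) f s (subst (_≤ mc (nfo (suc t))) (nfo-val (s≤s z≤n))
          (NFO-≻ (nfo-NFO (s≤s z≤n)) (nfo-NFO (s≤s z≤n)) (≺-≼-trans q l)
                 (subst₂ _≤_ (sym (nfo-val (s≤s z≤n))) (sym (nfo-val (s≤s z≤n))) p)))

    below : ∀ {u} → Acc _<_ u → Below u
    below {u} (acc r) = go u λ q → below (r q)

  Sub-inv : NFO ξ → Sub x v (val ξ) → x ≼ ξ → val ξ ≤ v
  Sub-inv {ξ} {x} {v} p s q = go s refl
    where
    go : Sub x v t → t ≡ val ξ → val ξ ≤ v
    go (stop r) refl = r
    go (step r _) e = ⊥-elim (≺⇒⋡ r (subst (_ ≼_) (sym (trans (cong nfo e) (nfo-unique p))) q))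

  -- If 𝔸(x) ≤ t + 1, then `skipped` gives a normal form ρ ≥ x with mc x < 𝔸(ρ) ≤ mc (`nfo` (t +
  -- 1)). By `Sub-≤` the derivation covers 𝔸(ρ), but there it can only stop, since ρ is not below x.
  Sub⇒< : Nf x → Sub x (mc x) t → t < val x
  Sub⇒< nx (stop p) = ≤-<-trans p (mc<val nx)
  Sub⇒< {x} nx (step {t} p s) with val x ≤? suc t
  ... | no ¬q = ≰⇒> ¬q
  ... | yes q with skipped (nfo-Ch {suc t} (s≤s z≤n)) (nfo-val (s≤s z≤n)) nx p q
  ...   | ρ , ch , r , u , w = ⊥-elim (<⇒≱ u (Sub-inv (Ch⇒NFO ch) (Sub-≤ s w) r))

  <⇒Sub : NFO ξ → t < val ξ → Sub ξ (mc ξ) t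
  <⇒Sub {ξ} {t} p q = go t (<-wellFounded t) q
    where
    go : ∀ t → Acc _<_ t → t < val ξ → Sub ξ (mc ξ) t
    go zero _ _ = stop z≤n
    go (suc t) (acc r) q with tri (nfo (suc t)) ξ
    ... | tri≺ l = step l (go _ (r (mc-nfo-< t)) (<-trans (mc-nfo-< t) q))
    ... | tri≡ refl = ⊥-elim (<⇒≢ q (sym (nfo-val (s≤s z≤n))))
    ... | tri≻ l = stop (subst (_≤ mc ξ) (nfo-val (s≤s z≤n))
          (NFO-≻ p (nfo-NFO (s≤s z≤n)) l (≤-trans (≤-reflexive (nfo-val (s≤s z≤n))) (<⇒≤ q))))

-- Base change on limit ordinals

-- When f is the base change of numbers, this is the base change of ordinals: by `plusTerm-Nf` the
-- sum in its definition keeps the shape of the term.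
mapC : (ℕ → ℕ) → Ord → Ord
mapC f 𝟎 = 𝟎
mapC f (cnf a b c) = cnf (mapC f a) (f b) (mapC f c)

cnf-inj : cnf a b c ≡ cnf a' b' c' → a ≡ a' × b ≡ b' × c ≡ c'
cnf-inj refl = refl , refl , refl

≺t⁻ : cnf a b x ≼ cnf a b y → x ≼ y
≺t⁻ (inj₁ (≺e p)) = ⊥-elim (≺-irrefl p)
≺t⁻ (inj₁ (≺n p)) = ⊥-elim (<-irrefl refl p)
≺t⁻ (inj₁ (≺t p)) = inj₁ p
≺t⁻ (inj₂ refl) = inj₂ refl

≼t : x ≼ y → cnf a b x ≼ cnf a b y
≼t (inj₁ p) = inj₁ (≺t p)
≼t (inj₂ refl) = inj₂ refl

<⊔⁻ : ∀ m n → t < m ⊔ n → t < m ⊎ t < n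
<⊔⁻ m n p with ⊔-sel m n
... | inj₁ q = inj₁ (subst (_ <_) q p)
... | inj₂ q = inj₂ (subst (_ <_) q p)

≤⊔⁻ : ∀ m n → t ≤ m ⊔ n → t ≤ m ⊎ t ≤ n
≤⊔⁻ m n p with ⊔-sel m n
... | inj₁ q = inj₁ (subst (_ ≤_) q p)
... | inj₂ q = inj₂ (subst (_ ≤_) q p)

data OneOf₃ (P Q R : Set) : Set where
  1st : P → OneOf₃ P Q R
  2nd : Q → OneOf₃ P Q R
  3rd : R → OneOf₃ P Q R

<mc⁻ : ∀ a b c → t < mc (cnf a b c) → OneOf₃ (t < mc a) (t < b) (t < mc c)
<mc⁻ a b c p with <⊔⁻ (mc a) (mc c ⊔ b) p
... | inj₁ q = 1st q
... | inj₂ q with <⊔⁻ (mc c) b q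
...   | inj₁ r = 3rd r
...   | inj₂ r = 2nd r

≤mc⁻ : ∀ a b c → t ≤ mc (cnf a b c) → OneOf₃ (t ≤ mc a) (t ≤ b) (t ≤ mc c)
≤mc⁻ a b c p with ≤⊔⁻ (mc a) (mc c ⊔ b) p
... | inj₁ q = 1st q
... | inj₂ q with ≤⊔⁻ (mc c) b q
...   | inj₁ r = 3rd r
...   | inj₂ r = 2nd r

-- β = ω^e·b + γ  with  b > 0  and  γ ≤ ω^e  limits.
record HeadTail (β e : Ord) (b : ℕ) (γ : Ord) : Set where
  field
    fs-eq : ∀ {w} → fs β w ≡ cnf e b (fs γ w)
    ≺⁻ : ∀ {x} → Nf x → x ≺ β → x ≺ cnf e b 𝟎 ⊎ ∃ λ c → x ≡ cnf e b c × c ≺ γ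
    ≺-head : ∀ {x} → x ≺ cnf e b 𝟎 → x ≺ β
    ≺-tail : ∀ {c} → c ≺ γ → cnf e b c ≺ β

headTail-lc : Lim c → HeadTail (cnf e b c) e b c
headTail-lc {c} {e} {b} l = record
  { fs-eq = fs-lc l e b _
  ; ≺⁻ = λ _ → below
  ; ≺-head = λ p → ≺-≼-trans p (≼t (𝟎≼ c))
  ; ≺-tail = ≺t }
  where
  below : ∀ {x} → x ≺ cnf e b c → x ≺ cnf e b 𝟎 ⊎ ∃ λ c' → x ≡ cnf e b c' × c' ≺ c
  below ≺𝟎 = inj₁ ≺𝟎
  below (≺e p) = inj₁ (≺e p)
  below (≺n p) = inj₁ (≺n p)
  below (≺t p) = inj₂ (_ , refl , p)

-- One copy of ω^e is split off as the tail, so that ω^e·(b+1) and sums with a limit tail can be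
-- treated alike.
headTail-lb : 0 < b → HeadTail (cnf e (suc b) 𝟎) e b (cnf e 1 𝟎)
headTail-lb {suc b} {e} (s≤s _) = record
  { fs-eq = refl
  ; ≺⁻ = below
  ; ≺-head = λ p → ≺-trans p (≺n ≤-refl)
  ; ≺-tail = λ _ → ≺n ≤-refl }
  where
  below : ∀ {x} → Nf x → x ≺ cnf e (suc (suc b)) 𝟎 → x ≺ cnf e (suc b) 𝟎 ⊎ ∃ λ c → x ≡ cnf e (suc b) c × c ≺ cnf e 1 𝟎
  below n ≺𝟎 = inj₁ ≺𝟎
  below n (≺e p) = inj₁ (≺e p)
  below n (≺n (s≤s p)) with m≤n⇒m<n∨m≡n p
  ... | inj₁ q = inj₁ (≺n q)
  ... | inj₂ refl = inj₂ (_ , refl , ◂⇒≺ (tail-◂ n))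

-- φ is left abstract because it is first instantiated with an extension of base change from an
-- initial segment, before base change is known to be increasing everywhere.
module CoefChange (φ : ℕ → ℕ) (φ0 : φ 0 ≡ 0) (φ1 : φ 1 ≡ 1) (φ-< : ∀ {s t} → s < t → φ s < φ t) where

  Φ : Ord → Ord
  Φ = mapC φ

  φ-≤ : m ≤ n → φ m ≤ φ n
  φ-≤ p with m≤n⇒m<n∨m≡n p
  ... | inj₁ q = <⇒≤ (φ-< q)
  ... | inj₂ refl = ≤-refl

  φ-<⁻ : φ m < φ n → m < n
  φ-<⁻ p = ≰⇒> λ q → <⇒≱ p (φ-≤ q)

  φ-≤⁻ : φ m ≤ φ n → m ≤ n
  φ-≤⁻ p = ≮⇒≥ λ q → <⇒≱ (φ-< q) p

  φ-inj : φ m ≡ φ n → m ≡ n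
  φ-inj p = ≤-antisym (φ-≤⁻ (≤-reflexive p)) (φ-≤⁻ (≤-reflexive (sym p)))

  ≤φ : ∀ n → n ≤ φ n
  ≤φ zero = z≤n
  ≤φ (suc n) = ≤-<-trans (≤φ n) (φ-< ≤-refl)

  φ-pos : 0 < n → 0 < φ n
  φ-pos {n} p = ≤-trans p (≤φ n)

  φ-pos⁻ : 0 < φ n → 0 < n
  φ-pos⁻ {n} p = φ-<⁻ {0} {n} (subst (_< φ n) (sym φ0) p)

  Φ-mc : ∀ x → mc (Φ x) ≡ φ (mc x)
  Φ-mc 𝟎 = sym φ0
  Φ-mc (cnf a b c) rewrite Φ-mc a | Φ-mc c
    | mono-≤-distrib-⊔ φ-≤ (mc a) (mc c ⊔ b) | mono-≤-distrib-⊔ φ-≤ (mc c) b = refl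

  Φ-≺ : x ≺ y → Φ x ≺ Φ y
  Φ-≺ ≺𝟎 = ≺𝟎
  Φ-≺ (≺e p) = ≺e (Φ-≺ p)
  Φ-≺ (≺n p) = ≺n (φ-< p)
  Φ-≺ (≺t p) = ≺t (Φ-≺ p)

  Φ-≺⁻ : Φ x ≺ Φ y → x ≺ y
  Φ-≺⁻ {x} {y} p with tri x y
  ... | tri≺ q = q
  ... | tri≡ refl = ⊥-elim (≺-irrefl p)
  ... | tri≻ q = ⊥-elim (≺-irrefl (≺-trans p (Φ-≺ q)))

  Φ-inj : Φ x ≡ Φ y → x ≡ y
  Φ-inj {x} {y} p with tri x y
  ... | tri≺ q = ⊥-elim (≺⇒⋡ (Φ-≺ q) (inj₂ (sym p)))
  ... | tri≡ q = q
  ... | tri≻ q = ⊥-elim (≺⇒⋡ (Φ-≺ q) (inj₂ p))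

  Φ-◂ : x ◂ y → Φ x ◂ Φ y
  Φ-◂ ◂𝟎 = ◂𝟎
  Φ-◂ (◂c p) = ◂c (Φ-≺ p)

  Φ-◂⁻ : ∀ x → Φ x ◂ Φ y → x ◂ y
  Φ-◂⁻ 𝟎 p = ◂𝟎
  Φ-◂⁻ (cnf _ _ _) (◂c p) = ◂c (Φ-≺⁻ p)

  Φ-Nf : Nf x → Nf (Φ x)
  Φ-Nf nf0 = nf0
  Φ-Nf (nfc p q r) = pos-nf (φ-pos (s≤s z≤n)) (Φ-Nf p) (Φ-Nf q) (Φ-◂ r)

  Φ-Nf⁻ : ∀ x → Nf (Φ x) → Nf x
  Φ-Nf⁻ 𝟎 _ = nf0
  Φ-Nf⁻ (cnf a b c) p = pos-nf (φ-pos⁻ (pos-of-nf p)) (Φ-Nf⁻ a (exp-Nf p)) (Φ-Nf⁻ c (tail-Nf p)) (Φ-◂⁻ c (tail-◂ p))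

  Φ-fin : ∀ n → Φ (fin n) ≡ fin (φ n)
  Φ-fin zero = sym (cong fin φ0)
  Φ-fin (suc n) with φ (suc n) | φ-pos {suc n} (s≤s z≤n)
  ... | suc _ | _ = refl

  Φ-addFin : ∀ α n → Φ (addFin α n) ≡ addFin (Φ α) (φ n)
  Φ-addFin 𝟎 n = Φ-fin n
  Φ-addFin (cnf a b c) n = cong (cnf (Φ a) (φ b)) (Φ-addFin c n)

  Φ-LZ : LZ α → LZ (Φ α)
  Φ-Lim : Lim α → Lim (Φ α)
  Φ-Pos : Pos e → Pos (Φ e)
  Φ-LZ lz = lz
  Φ-LZ (ll l) = ll (Φ-Lim l)
  Φ-Lim (lc {b = b} l) with φ (suc b) | φ-pos {suc b} (s≤s z≤n)
  ... | suc _ | _ = lc (Φ-Lim l)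
  Φ-Lim (lb {b = b} l) with φ (suc b) | φ-pos {suc b} (s≤s z≤n)
  ... | suc _ | _ = lb (Φ-Pos l)
  Φ-Pos (ps {α} {z = z} l refl) with φ (suc z) | φ-pos {suc z} (s≤s z≤n) | Φ-addFin α (suc z)
  ... | suc _ | _ | p = ps (Φ-LZ l) p
  Φ-Pos (pl l) = pl (Φ-Lim l)

  imageℕ? : ∀ b → Dec (∃ λ s → φ s ≡ b)
  imageℕ? b = go b (≤φ b)
    where
    go : ∀ s → b ≤ φ s → Dec (∃ λ s → φ s ≡ b)
    go s p with m≤n⇒m<n∨m≡n p
    go s p | inj₂ q = yes (s , sym q)
    go zero p | inj₁ q = ⊥-elim (<⇒≱ q (subst (_≤ b) (sym φ0) z≤n))
    go (suc s) p | inj₁ q with b ≤? φ s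
    ... | yes r = go s r
    ... | no ¬r = no λ { (t , refl) → <⇒≱ (φ-<⁻ (≰⇒> ¬r)) (≤-pred (φ-<⁻ q)) }

  image? : ∀ x → Dec (∃ λ y → Φ y ≡ x)
  image? 𝟎 = yes (𝟎 , refl)
  image? (cnf a b c) with image? a | imageℕ? b | image? c
  ... | yes (a₀ , refl) | yes (b₀ , refl) | yes (c₀ , refl) = yes (cnf a₀ b₀ c₀ , refl)
  ... | no ¬p | _ | _ = no λ { (cnf a₀ _ _ , refl) → ¬p (a₀ , refl) }
  ... | _ | no ¬p | _ = no λ { (cnf _ b₀ _ , refl) → ¬p (b₀ , refl) }
  ... | _ | _ | no ¬p = no λ { (cnf _ _ c₀ , refl) → ¬p (c₀ , refl) }

  Gap : Ord → Set
  Gap β = ∀ {τ w} → Nf τ → Φ τ ≺ β → mc β < w → Φ τ ≺ fs β w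

  -- β is the supremum of the images of the ordinals below the limit α.
  record Exact (β α : Ord) : Set where
    field
      nf : Nf α
      lim : Lim α
      below : ∀ {τ} → Nf τ → τ ≺ α → Φ τ ≺ β
      above : ∀ {τ} → Nf τ → Φ τ ≺ β → τ ≺ α
      -- Pulls β[w] ≤ Φ τ back to α[u] ≤ τ, provided that coefficients of τ whose images reach w are
      -- themselves at least u.
      approx : ∀ {τ u w} → Nf τ → 0 < u → 0 < w → (∀ {s} → s ≤ mc τ → w ≤ φ s → u ≤ s) →
               fs β w ≼ Φ τ → Φ τ ≺ β → fs α u ≼ τ
      -- β need not be Φ α: below ω^(z+1) the values have supremum ω^(φ(z)+1), possibly less than
      -- ω^φ(z+1). So mc β is only located relative to the values of φ near mc α.
      <mc : ∀ {t} → t < mc α → φ t ≤ mc β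
      ≤mc : ∀ {t} → φ t ≤ mc β → t ≤ mc α

  Exact-preimage : Exact β α → Nf ξ → Φ ξ ≡ β → ξ ≡ α
  Exact-preimage {α = α} {ξ = ξ} E n refl with tri ξ α
  ... | tri≡ p = p
  ... | tri≺ p = ⊥-elim (≺-irrefl (Exact.below E n p))
  ... | tri≻ p = ⊥-elim (≺-irrefl (Exact.above E (Exact.nf E) (Φ-≺ p)))

  Gap-headTail : HeadTail β e b ζ → mc ζ ≤ mc β →
    (∀ {τ c} → Nf τ → Φ τ ≡ cnf e b c → c ≺ ζ → ∀ {w} → mc ζ < w → c ≺ fs ζ w) → Gap β
  Gap-headTail {β} {e} {b} {ζ} H m f {τ} {w} n p q = subst (Φ τ ≺_) (sym fs-eq) (go (≺⁻ (Φ-Nf n) p))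
    where
    open HeadTail H
    go : Φ τ ≺ cnf e b 𝟎 ⊎ (∃ λ c → Φ τ ≡ cnf e b c × c ≺ ζ) → Φ τ ≺ cnf e b (fs ζ w)
    go (inj₁ r) = ≺-≼-trans r (≼t (𝟎≼ _))
    go (inj₂ (c , r , s)) = subst (_≺ cnf e b (fs ζ w)) (sym r) (≺t (f n r s (≤-<-trans m q)))

  cnf-preimage : ∀ τ → Φ τ ≡ cnf e b c → ∃ λ e₀ → ∃ λ b₀ → ∃ λ c₀ → τ ≡ cnf e₀ b₀ c₀ × Φ e₀ ≡ e × φ b₀ ≡ b × Φ c₀ ≡ c
  cnf-preimage (cnf a b c) p = a , b , c , refl , cnf-inj p

  ¬image-exp : ¬ (∃ λ y → Φ y ≡ e) → ∀ τ → Φ τ ≢ cnf e b c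
  ¬image-exp ¬p (cnf e₀ _ _) refl = ¬p (e₀ , refl)

  ¬image-coef : ¬ (∃ λ s → φ s ≡ b) → ∀ τ → Φ τ ≢ cnf e b c
  ¬image-coef ¬p (cnf _ b₀ _) refl = ¬p (b₀ , refl)

  Gap-headTail-image : HeadTail β e b ζ → mc ζ ≤ mc β → Gap ζ → Gap β
  Gap-headTail-image {ζ = ζ} H m g = Gap-headTail H m λ {τ} n p q r → go τ n p q r
    where
    go : ∀ τ {c} → Nf τ → Φ τ ≡ cnf e b c → c ≺ ζ → ∀ {w} → mc ζ < w → c ≺ fs ζ w
    go τ n p q r with cnf-preimage τ p
    ... | _ , _ , _ , refl , refl , refl , refl = g (tail-Nf n) q r

  -- A value of Φ below β lies below the common head or begins with it; in the latter case the tails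
  -- decide. The bounds on mc depend on how α is normalised and are left to the caller.
  Exact-headTail : ∀ {a₀ b₀ γ γ₀} → HeadTail β (Φ a₀) (φ b₀) γ → Exact γ γ₀ → HeadTail α a₀ b₀ γ₀ →
    Nf α → Lim α → (∀ {t} → t < mc α → φ t ≤ mc β) → (∀ {t} → φ t ≤ mc β → t ≤ mc α) → Exact β α
  Exact-headTail {β} {α} {a₀} {b₀} {γ} {γ₀} Hβ E Hα n l m₁ m₂ = record
    { nf = n ; lim = l ; <mc = m₁ ; ≤mc = m₂
    ; below = λ nτ p → below' nτ (α.≺⁻ nτ p)
    ; above = λ {τ} nτ p → above' τ nτ (β.≺⁻ (Φ-Nf nτ) p)
    ; approx = λ {τ} nτ pu pw f p q → approx' τ nτ pu pw f p (β.≺⁻ (Φ-Nf nτ) q) }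
    where
    module α = HeadTail Hα
    module β = HeadTail Hβ
    module E = Exact E
    head : ∀ {τ} → Φ τ ≺ cnf (Φ a₀) (φ b₀) 𝟎 → τ ≺ cnf a₀ b₀ 𝟎
    head {τ} = Φ-≺⁻ {τ} {cnf a₀ b₀ 𝟎}
    below' : ∀ {τ} → Nf τ → τ ≺ cnf a₀ b₀ 𝟎 ⊎ (∃ λ c → τ ≡ cnf a₀ b₀ c × c ≺ γ₀) → Φ τ ≺ β
    below' nτ (inj₁ p) = β.≺-head (Φ-≺ p)
    below' nτ (inj₂ (c , refl , p)) = β.≺-tail (E.below (tail-Nf nτ) p)
    above' : ∀ τ → Nf τ → Φ τ ≺ cnf (Φ a₀) (φ b₀) 𝟎 ⊎ (∃ λ c → Φ τ ≡ cnf (Φ a₀) (φ b₀) c × c ≺ γ) → τ ≺ α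
    above' τ nτ (inj₁ p) = α.≺-head (head {τ} p)
    above' τ nτ (inj₂ (c , p , q)) with cnf-preimage τ p
    ... | a₁ , b₁ , c₁ , refl , r , s , refl rewrite Φ-inj {a₁} {a₀} r | φ-inj {b₁} {b₀} s = α.≺-tail (E.above (tail-Nf nτ) q)
    approx' : ∀ τ {u w} → Nf τ → 0 < u → 0 < w → (∀ {s} → s ≤ mc τ → w ≤ φ s → u ≤ s) → fs β w ≼ Φ τ →
      Φ τ ≺ cnf (Φ a₀) (φ b₀) 𝟎 ⊎ (∃ λ c → Φ τ ≡ cnf (Φ a₀) (φ b₀) c × c ≺ γ) → fs α u ≼ τ
    approx' τ {u} {w} nτ pu pw f p (inj₁ q) =
      ⊥-elim (≺⇒⋡ q (≼-trans (≼t (𝟎≼ (fs γ w))) (subst (_≼ Φ τ) β.fs-eq p)))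
    approx' τ {u} {w} nτ pu pw f p (inj₂ (c , q , r)) with cnf-preimage τ q
    ... | a₁ , b₁ , c₁ , refl , q₁ , q₂ , refl with Φ-inj {a₁} {a₀} q₁ | φ-inj {b₁} {b₀} q₂
    ...   | refl | refl = subst (_≼ τ) (sym α.fs-eq) (≼t (E.approx (tail-Nf nτ) pu pw
              (λ s → f (≤-trans s (mc-tail a₀ b₀ c₁))) (≺t⁻ (subst (_≼ Φ τ) β.fs-eq p)) r))

  -- Every limit is a gap or a supremum of values

  Dichotomy : Ord → Set
  Dichotomy β = Gap β ⊎ ∃ (Exact β)

  mc-unit≤ : ∀ e b → mc (cnf e 1 𝟎) ≤ mc (cnf e (suc b) 𝟎)
  mc-unit≤ e b = ⊔-lub (mc-exp e (suc b) 𝟎) (≤-trans (s≤s z≤n) (mc-coef e (suc b) 𝟎))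

  -- If e or b is not in the image, no value of Φ begins with ω^e·b, which leaves a gap. Otherwise
  -- the tail decides.
  dichotomy-lc : Nf (cnf e b β) → Lim β → Dichotomy β → Dichotomy (cnf e b β)
  dichotomy-lc {e} {b} {β} n l d with image? e | imageℕ? b
  ... | no ¬p | _ = inj₁ (Gap-headTail (headTail-lc l) (mc-tail e b β) λ {τ} _ q → ⊥-elim (¬image-exp ¬p τ q))
  ... | yes _ | no ¬p = inj₁ (Gap-headTail (headTail-lc l) (mc-tail e b β) λ {τ} _ q → ⊥-elim (¬image-coef ¬p τ q))
  dichotomy-lc {e} {b} {β} n l (inj₁ g) | yes _ | yes _ =
    inj₁ (Gap-headTail-image (headTail-lc l) (mc-tail e b β) g)
  dichotomy-lc {β = β} n l (inj₂ (α , E)) | yes (a₀ , refl) | yes (b₀ , refl) =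
    inj₂ (go (tri α (cnf a₀ 1 𝟎)))
    where
    module E = Exact E
    na : Nf a₀
    na = Φ-Nf⁻ a₀ (exp-Nf n)
    b₀-pos : 0 < b₀
    b₀-pos = φ-pos⁻ (pos-of-nf n)
    mce : mc (Φ a₀) ≤ mc (cnf (Φ a₀) (φ b₀) β)
    mce = mc-exp (Φ a₀) (φ b₀) β
    mcb : φ b₀ ≤ mc (cnf (Φ a₀) (φ b₀) β)
    mcb = mc-coef (Φ a₀) (φ b₀) β
    mcβ : mc β ≤ mc (cnf (Φ a₀) (φ b₀) β)
    mcβ = mc-tail (Φ a₀) (φ b₀) β
    via-exp : φ t ≤ mc (Φ a₀) → t ≤ mc a₀
    via-exp {t} p = φ-≤⁻ (subst (φ t ≤_) (Φ-mc a₀) p)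
    from-exp : t < mc a₀ → φ t ≤ mc (cnf (Φ a₀) (φ b₀) β)
    from-exp {t} p = ≤-trans (subst (φ t ≤_) (sym (Φ-mc a₀)) (φ-≤ (<⇒≤ p))) mce
    lim-cons : ∀ {a b c} → 0 < b → Lim c → Lim (cnf a b c)
    lim-cons (s≤s _) = lc
    go : Tri α (cnf a₀ 1 𝟎) → ∃ (Exact (cnf (Φ a₀) (φ b₀) β))
    go (tri≺ p) = cnf a₀ b₀ α , Exact-headTail (headTail-lc l) E (headTail-lc E.lim)
        (pos-nf b₀-pos na E.nf (≺⇒◂ E.nf p)) (lim-cons b₀-pos E.lim) lo hi
      where
      lo : t < mc (cnf a₀ b₀ α) → φ t ≤ mc (cnf (Φ a₀) (φ b₀) β)
      lo q with <mc⁻ a₀ b₀ α q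
      ... | 1st r = from-exp r
      ... | 2nd r = ≤-trans (φ-≤ (<⇒≤ r)) mcb
      ... | 3rd r = ≤-trans (E.<mc r) mcβ
      hi : φ t ≤ mc (cnf (Φ a₀) (φ b₀) β) → t ≤ mc (cnf a₀ b₀ α)
      hi q with ≤mc⁻ (Φ a₀) (φ b₀) β q
      ... | 1st r = ≤-trans (via-exp r) (mc-exp a₀ b₀ α)
      ... | 2nd r = ≤-trans (φ-≤⁻ r) (mc-coef a₀ b₀ α)
      ... | 3rd r = ≤-trans (E.≤mc r) (mc-tail a₀ b₀ α)
    -- The preimage of the tail has grown to a full ω^a₀, so the sum renormalises to ω^a₀·(b₀+1).
    go (tri≡ refl) = cnf a₀ (suc b₀) 𝟎 , Exact-headTail (headTail-lc l) E (headTail-lb b₀-pos)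
        (nfc na nf0 ◂𝟎) (lb (pos E.lim)) lo hi
      where
      pos : Lim (cnf a₀ 1 𝟎) → Pos a₀
      pos (lb p) = p
      lo : t < mc (cnf a₀ (suc b₀) 𝟎) → φ t ≤ mc (cnf (Φ a₀) (φ b₀) β)
      lo q with <mc⁻ a₀ (suc b₀) 𝟎 q
      ... | 1st r = from-exp r
      ... | 2nd (s≤s r) = ≤-trans (φ-≤ r) mcb
      ... | 3rd ()
      hi : φ t ≤ mc (cnf (Φ a₀) (φ b₀) β) → t ≤ mc (cnf a₀ (suc b₀) 𝟎)
      hi q with ≤mc⁻ (Φ a₀) (φ b₀) β q
      ... | 1st r = ≤-trans (via-exp r) (mc-exp a₀ (suc b₀) 𝟎)
      ... | 2nd r = ≤-trans (m≤n⇒m≤1+n (φ-≤⁻ r)) (mc-coef a₀ (suc b₀) 𝟎)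
      ... | 3rd r = ≤-trans (E.≤mc r) (mc-unit≤ a₀ b₀)
    -- Since φ 1 = 1, ω^a₀ would be mapped to ω^(Φ a₀), which exceeds the tail β.
    go (tri≻ p) = ⊥-elim (≺-irrefl (≺-trans
      (subst (λ s → cnf (Φ a₀) s 𝟎 ≺ β) φ1 (E.below {cnf a₀ 1 𝟎} (nfc na nf0 ◂𝟎) p)) (◂⇒≺ (tail-◂ n))))

  dichotomy-lb : Nf e → 0 < b → Dichotomy (cnf e 1 𝟎) → Dichotomy (cnf e (suc b) 𝟎)
  dichotomy-lb {e} {b} n 0<b d with image? e | imageℕ? b
  ... | no ¬p | _ = inj₁ (Gap-headTail (headTail-lb 0<b) (mc-unit≤ e b) λ {τ} _ q → ⊥-elim (¬image-exp ¬p τ q))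
  ... | yes _ | no ¬p = inj₁ (Gap-headTail (headTail-lb 0<b) (mc-unit≤ e b) λ {τ} _ q → ⊥-elim (¬image-coef ¬p τ q))
  dichotomy-lb {e} {b} n 0<b (inj₁ g) | yes _ | yes _ =
    inj₁ (Gap-headTail-image (headTail-lb 0<b) (mc-unit≤ e b) g)
  dichotomy-lb n 0<b (inj₂ (α , E)) | yes (a₀ , refl) | yes (b₀ , refl)
    with Exact-preimage E (nfc (Φ-Nf⁻ a₀ n) nf0 ◂𝟎) (cong (λ s → cnf (Φ a₀) s 𝟎) φ1)
  ... | refl = inj₂ (cnf a₀ (suc b₀) 𝟎 , Exact-headTail (headTail-lb 0<b) E (headTail-lb (φ-pos⁻ 0<b))
        (nfc (Φ-Nf⁻ a₀ n) nf0 ◂𝟎) (lb (pos (Exact.lim E))) lo hi)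
    where
    pos : Lim (cnf a₀ 1 𝟎) → Pos a₀
    pos (lb p) = p
    lo : t < mc (cnf a₀ (suc b₀) 𝟎) → φ t ≤ mc (cnf (Φ a₀) (suc (φ b₀)) 𝟎)
    lo {t} q with <mc⁻ a₀ (suc b₀) 𝟎 q
    ... | 1st r = ≤-trans (subst (φ t ≤_) (sym (Φ-mc a₀)) (φ-≤ (<⇒≤ r))) (mc-exp (Φ a₀) (suc (φ b₀)) 𝟎)
    ... | 2nd (s≤s r) = ≤-trans (m≤n⇒m≤1+n (φ-≤ r)) (mc-coef (Φ a₀) (suc (φ b₀)) 𝟎)
    ... | 3rd ()
    hi : φ t ≤ mc (cnf (Φ a₀) (suc (φ b₀)) 𝟎) → t ≤ mc (cnf a₀ (suc b₀) 𝟎)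
    hi {t} q with ≤mc⁻ (Φ a₀) (suc (φ b₀)) 𝟎 q
    ... | 1st r = ≤-trans (φ-≤⁻ (subst (φ t ≤_) (Φ-mc a₀) r)) (mc-exp a₀ (suc b₀) 𝟎)
    ... | 2nd r = ≤-trans (φ-≤⁻ (≤-trans r (φ-< ≤-refl))) (mc-coef a₀ (suc b₀) 𝟎)
    ... | 3rd r = ≤-trans (φ-≤⁻ (≤-trans r z≤n)) z≤n

  unit-above : ∀ τ → Nf τ → Φ τ ≺ cnf e 1 𝟎 → (∀ {a} → Nf a → Φ a ≺ e → a ≺ ζ) → τ ≺ cnf ζ 1 𝟎
  unit-above 𝟎 _ _ f = ≺𝟎
  unit-above (cnf a b c) n p f with ≺⇒◂ (Φ-Nf n) p
  ... | ◂c q = ≺e (f (exp-Nf n) q)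

  unit-below : ∀ {τ} → Nf τ → τ ≺ cnf ζ 1 𝟎 → (∀ {a} → Nf a → a ≺ ζ → Φ a ≺ e) → Φ τ ≺ cnf e 1 𝟎
  unit-below n p f with ≺⇒◂ n p
  ... | ◂𝟎 = ≺𝟎
  ... | ◂c q = ≺e (f (exp-Nf n) q)

  <mc-unit : (∀ {t} → t < mc ζ → φ t ≤ mc e) → t < mc (cnf ζ 1 𝟎) → φ t ≤ mc (cnf e 1 𝟎)
  <mc-unit {ζ} {e} f p with <mc⁻ ζ 1 𝟎 p
  ... | 1st q = ≤-trans (f q) (mc-exp e 1 𝟎)
  ... | 2nd (s≤s z≤n) = subst (_≤ mc (cnf e 1 𝟎)) (sym φ0) z≤n
  ... | 3rd ()

  ≤mc-unit : (∀ {t} → φ t ≤ mc e → t ≤ mc ζ) → φ t ≤ mc (cnf e 1 𝟎) → t ≤ mc (cnf ζ 1 𝟎)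
  ≤mc-unit {e} {ζ} f p with ≤mc⁻ e 1 𝟎 p
  ... | 1st q = ≤-trans (f q) (mc-exp ζ 1 𝟎)
  ... | 2nd q = ≤-trans (≤φ _) (≤-trans q (mc-coef ζ 1 𝟎))
  ... | 3rd q = ≤-trans (≤φ _) (≤-trans q z≤n)

  -- If δ is not a value of Φ, then every value below ω^(δ+1) has leading exponent below δ and so
  -- lies below ω^δ. If δ = Φ(δ₀), the values with leading exponent δ come from ω^δ₀·n + γ and are
  -- cofinal.
  dichotomy-suc : LZ α → Nf (addFin α (suc z)) → Dichotomy (cnf (addFin α (suc z)) 1 𝟎)
  dichotomy-suc {α} {z} l n with image? (addFin α z)
  ... | no ¬p = inj₁ λ {τ} nτ p q → subst (Φ τ ≺_) (sym (ωfs-s {z = z} l (≤-trans (s≤s z≤n) q))) (go τ nτ p)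
    where
    go : ∀ τ → Nf τ → Φ τ ≺ cnf (addFin α (suc z)) 1 𝟎 → Φ τ ≺ cnf (addFin α z) w 𝟎
    go 𝟎 _ _ = ≺𝟎
    go (cnf a b c) nτ p with ≺⇒◂ (Φ-Nf nτ) p
    ... | ◂c q with ≺-addFin-suc (Φ-Nf (exp-Nf nτ)) l q
    ...   | inj₁ r = ≺e r
    ...   | inj₂ r = ⊥-elim (¬p (a , r))
  ... | yes (δ , δeq) = inj₂ (go (toView nδ) δeq)
    where
    nα : Nf α
    nα = Pos-pred-Nf l n
    nδ : Nf δ
    nδ = Φ-Nf⁻ δ (subst Nf (sym δeq) (addFin-Nf l nα z))
    go : ∀ {δ} → View δ → Φ δ ≡ addFin α z → ∃ (Exact (cnf (addFin α (suc z)) 1 𝟎))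
    go (view {α₀} l₀ n₀ z₀) q with addFin-injective (Φ-LZ l₀) l (trans (sym (Φ-addFin α₀ z₀)) q)
    ... | refl , refl = cnf (addFin α₀ (suc z₀)) 1 𝟎 , record
      { nf = nfc (addFin-Nf l₀ n₀ (suc z₀)) nf0 ◂𝟎
      ; lim = lb (ps l₀ refl)
      ; below = λ nτ p → unit-below nτ p exp-below
      ; above = λ {τ} nτ p → unit-above τ nτ p exp-above
      ; approx = λ {τ} → approx' τ
      ; <mc = <mc-unit {addFin α₀ (suc z₀)} {addFin (Φ α₀) (suc (φ z₀))} lo
      ; ≤mc = ≤mc-unit {addFin (Φ α₀) (suc (φ z₀))} {addFin α₀ (suc z₀)} hi }
      where
      exp-below : ∀ {a} → Nf a → a ≺ addFin α₀ (suc z₀) → Φ a ≺ addFin (Φ α₀) (suc (φ z₀))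
      exp-below {a} na p = ≼-≺-trans (Φ-≼ (≺-addFin-suc na l₀ p)) (addFin-≺ (Φ α₀) ≤-refl)
        where
        Φ-≼ : a ≼ addFin α₀ z₀ → Φ a ≼ addFin (Φ α₀) (φ z₀)
        Φ-≼ (inj₁ p) = inj₁ (subst (Φ a ≺_) (Φ-addFin α₀ z₀) (Φ-≺ p))
        Φ-≼ (inj₂ refl) = inj₂ (Φ-addFin α₀ z₀)
      pred-≼ : ∀ {a} → Nf a → Φ a ≺ addFin (Φ α₀) (suc (φ z₀)) → a ≺ addFin α₀ z₀ ⊎ a ≡ addFin α₀ z₀
      pred-≼ {a} na p with ≺-addFin-suc (Φ-Nf na) (Φ-LZ l₀) p
      ... | inj₁ q = inj₁ (Φ-≺⁻ (subst (Φ a ≺_) (sym (Φ-addFin α₀ z₀)) q))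
      ... | inj₂ q = inj₂ (Φ-inj (trans q (sym (Φ-addFin α₀ z₀))))
      exp-above : ∀ {a} → Nf a → Φ a ≺ addFin (Φ α₀) (suc (φ z₀)) → a ≺ addFin α₀ (suc z₀)
      exp-above na p = ≼-≺-trans (pred-≼ na p) (addFin-≺ α₀ ≤-refl)
      approx' : ∀ τ {u w} → Nf τ → 0 < u → 0 < w → (∀ {s} → s ≤ mc τ → w ≤ φ s → u ≤ s) →
        fs (cnf (addFin (Φ α₀) (suc (φ z₀))) 1 𝟎) w ≼ Φ τ → Φ τ ≺ cnf (addFin (Φ α₀) (suc (φ z₀))) 1 𝟎 →
        fs (cnf (addFin α₀ (suc z₀)) 1 𝟎) u ≼ τ
      approx' τ nτ pu pw f p q rewrite ωfs-s {z = φ z₀} (Φ-LZ l₀) pw | ωfs-s {z = z₀} l₀ pu with τ | nτ | p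
      ... | 𝟎 | _ | inj₁ ()
      ... | 𝟎 | _ | inj₂ ()
      ... | cnf a b c | nτ' | p' with ≺⇒◂ (Φ-Nf nτ') q
      ...   | ◂c r with pred-≼ (exp-Nf nτ') r
      ...     | inj₁ s = ⊥-elim (≺⇒⋡ (≺e (subst (Φ a ≺_) (Φ-addFin α₀ z₀) (Φ-≺ s))) p')
      ...     | inj₂ refl = ≤⇒cnf≼ (f (mc-coef a b c) (coef p'))
        where
        coef : ∀ {w x} → cnf (addFin (Φ α₀) (φ z₀)) w 𝟎 ≼ cnf (Φ (addFin α₀ z₀)) (φ b) x → w ≤ φ b
        coef p rewrite Φ-addFin α₀ z₀ with p
        ... | inj₁ (≺e r) = ⊥-elim (≺-irrefl r)
        ... | inj₁ (≺n r) = <⇒≤ r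
        ... | inj₁ (≺t r) = ≤-refl
        ... | inj₂ refl = ≤-refl
      lo : ∀ {t} → t < mc (addFin α₀ (suc z₀)) → φ t ≤ mc (addFin (Φ α₀) (suc (φ z₀)))
      lo {t} p rewrite mc-addFin α₀ (suc z₀) | mc-addFin (Φ α₀) (suc (φ z₀)) | Φ-mc α₀ with <⊔⁻ (mc α₀) (suc z₀) p
      ... | inj₁ q = ≤-trans (φ-≤ (<⇒≤ q)) (m≤m⊔n (φ (mc α₀)) _)
      ... | inj₂ (s≤s q) = ≤-trans (m≤n⇒m≤1+n (φ-≤ q)) (m≤n⊔m (φ (mc α₀)) _)
      hi : ∀ {t} → φ t ≤ mc (addFin (Φ α₀) (suc (φ z₀))) → t ≤ mc (addFin α₀ (suc z₀))
      hi {t} p rewrite mc-addFin α₀ (suc z₀) | mc-addFin (Φ α₀) (suc (φ z₀)) | Φ-mc α₀ with ≤⊔⁻ (φ (mc α₀)) (suc (φ z₀)) p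
      ... | inj₁ q = ≤-trans (φ-≤⁻ q) (m≤m⊔n (mc α₀) _)
      ... | inj₂ q = ≤-trans (φ-≤⁻ (≤-trans q (φ-< ≤-refl))) (m≤n⊔m (mc α₀) _)

  dichotomy-ω : Lim e → Dichotomy e → Dichotomy (cnf e 1 𝟎)
  dichotomy-ω {e} l (inj₁ g) = inj₁ λ {τ} {w} nτ p q → subst (Φ τ ≺_) (sym (ωfs-l l w)) (go τ nτ p (≤-<-trans (mc-exp e 1 𝟎) q))
    where
    go : ∀ τ → Nf τ → Φ τ ≺ cnf e 1 𝟎 → mc e < w → Φ τ ≺ cnf (fs e w) 1 𝟎
    go 𝟎 _ _ _ = ≺𝟎
    go (cnf a b c) nτ p q with ≺⇒◂ (Φ-Nf nτ) p
    ... | ◂c r = ≺e (g (exp-Nf nτ) r q)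
  dichotomy-ω {e} l (inj₂ (η₀ , E)) = inj₂ (cnf η₀ 1 𝟎 , record
    { nf = nfc E.nf nf0 ◂𝟎
    ; lim = lb (pl E.lim)
    ; below = λ nτ p → unit-below nτ p E.below
    ; above = λ {τ} nτ p → unit-above τ nτ p E.above
    ; approx = λ {τ} → approx' τ
    ; <mc = <mc-unit {η₀} {e} E.<mc
    ; ≤mc = ≤mc-unit {e} {η₀} E.≤mc })
    where
    module E = Exact E
    approx' : ∀ τ {u w} → Nf τ → 0 < u → 0 < w → (∀ {s} → s ≤ mc τ → w ≤ φ s → u ≤ s) →
      fs (cnf e 1 𝟎) w ≼ Φ τ → Φ τ ≺ cnf e 1 𝟎 → fs (cnf η₀ 1 𝟎) u ≼ τ
    approx' τ {u} {w} nτ pu pw f p q rewrite ωfs-l l w | ωfs-l E.lim u with τ | nτ | p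
    ... | 𝟎 | _ | inj₁ ()
    ... | 𝟎 | _ | inj₂ ()
    ... | cnf a b c | nτ' | p' with ≺⇒◂ (Φ-Nf nτ') q
    ...   | ◂c r with E.approx (exp-Nf nτ') pu pw (λ s → f (≤-trans s (mc-exp a b c))) (lead p') r
      where
      lead : ∀ {x y b c} → cnf x 1 𝟎 ≼ cnf y b c → x ≼ y
      lead (inj₁ (≺e r)) = inj₁ r
      lead (inj₁ (≺n r)) = inj₂ refl
      lead (inj₁ (≺t r)) = inj₂ refl
      lead (inj₂ refl) = inj₂ refl
    ...     | inj₁ s = inj₁ (≺e s)
    ...     | inj₂ refl = 1≼ (pos-of-nf nτ')

  dichotomy : Lim β → Nf β → Dichotomy β
  dichotomy-unit : Pos e → Nf e → Dichotomy (cnf e 1 𝟎)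
  dichotomy (lc l) n = dichotomy-lc n l (dichotomy l (tail-Nf n))
  dichotomy (lb {b = zero} p) n = dichotomy-unit p (exp-Nf n)
  dichotomy (lb {b = suc b} p) n = dichotomy-lb (exp-Nf n) (s≤s z≤n) (dichotomy-unit p (exp-Nf n))
  dichotomy-unit (ps l refl) n = dichotomy-suc l n
  dichotomy-unit (pl l) n = dichotomy-ω l (dichotomy l n)

-- Preservation of normal forms

module Preservation
  (κ : ℕ) (φ : ℕ → ℕ) (φ0 : φ 0 ≡ 0) (φ1 : φ 1 ≡ 1) (φ-< : ∀ {s t} → s < t → φ s < φ t)
  (ξ : Ord) (Nξ : NormalForm.NFO κ ξ)
  -- In the induction on m, mc ξ < m, so the numbers up to mc ξ are already settled.
  (good : ∀ {t} → 0 < t → t ≤ mc ξ → NormalForm.NFO (suc κ) (mapC φ (NormalForm.nfo κ t)) ×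
                                     NormalForm.val (suc κ) (mapC φ (NormalForm.nfo κ t)) ≡ φ t)
  where

  module L = NormalForm κ
  module U = NormalForm (suc κ)
  open CoefChange φ φ0 φ1 (λ {s} {t} → φ-< {s} {t})

  nξ : Nf ξ
  nξ = L.Ch-Nf Nξ

  nfo-φ : 0 < t → t ≤ mc ξ → U.nfo (φ t) ≡ Φ (L.nfo t)
  nfo-φ p q with good p q
  ... | r , s = trans (cong U.nfo (sym s)) (U.nfo-unique r)

  USub-step : 0 < t → t ≤ mc ξ → Φ (L.nfo t) ≺ x → U.Sub x v (φ (mc (L.nfo t))) → U.Sub x v (φ t)
  USub-step {t} p q r s = U.Sub-step (φ-pos p) (subst (_≺ _) (sym (nfo-φ p q)) r)
    (subst (U.Sub _ _) (trans (sym (Φ-mc (L.nfo t))) (cong mc (sym (nfo-φ p q)))) s)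

  USub-unfold : 0 < t → t ≤ mc ξ → U.Sub x v (φ t) → φ t ≤ v ⊎ Φ (L.nfo t) ≺ x × U.Sub x v (φ (mc (L.nfo t)))
  USub-unfold {t} p q s with U.Sub-unfold s
  ... | inj₁ r = inj₁ r
  ... | inj₂ (_ , r , s') = inj₂ (subst (_≺ _) (nfo-φ p q) r ,
    subst (U.Sub _ _) (trans (cong mc (nfo-φ p q)) (Φ-mc (L.nfo t))) s')

  -- `Sub` stands for mc (Φ ξ) < 𝔸(ζ). In this form the hypothesis can be handed down to β[w]
  -- (`sub-Y`) and pulled back to the smaller base (`sub-χ`).
  Claim : Ord → Set
  Claim ζ = Φ ξ ≺ ζ → U.Sub ζ (mc ζ) (φ (mc ξ)) → U.val (Φ ξ) < U.val ζ

  module Limit (β : Ord) (limβ : Lim β) (nβ : Nf β) (b : ℕ)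
    (IH : ∀ {y} → Nf y → y ≺ addFin β b → Claim y)
    (Φξ≺ : Φ ξ ≺ addFin β b) (sub : U.Sub (addFin β b) (mc (addFin β b)) (φ (mc ξ))) where

    β+b : Ord
    β+b = addFin β b

    subζ : t ≤ mc ξ → U.Sub β+b (mc β+b) (φ t)
    subζ p = U.Sub-≤ sub (φ-≤ p)

    mcζ : mc β+b ≡ mc β ⊔ b
    mcζ = mc-addFin β b

    Y : ℕ → Ord
    Y j = fs β (U.W β j)

    nY : ∀ j → Nf (Y j)
    nY j = fs-Nf limβ nβ (U.W-pos limβ nβ j)

    W≤mcY : ∀ j → U.W β j ≤ mc (Y j)
    W≤mcY j = ≤-mc-fs limβ (U.W-pos limβ nβ j)

    Y≺ζ : ∀ j → Y j ≺ β+b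
    Y≺ζ j = ≺-≼-trans (fs-≺ limβ (U.W-pos limβ nβ j)) (≼-addFin β b)

    mcζ≤W : suc b ≤ j → mc β+b ≤ U.W β j
    mcζ≤W {j} p = subst (_≤ U.W β j) (sym mcζ)
      (⊔-lub (≤-trans (m≤m+n (mc β) j) (U.W-growth limβ nβ j))
             (≤-trans (≤-trans (n≤1+n b) p) (≤-trans (m≤n+m j (mc β)) (U.W-growth limβ nβ j))))

    -- Rebuild the derivation for ζ over Y j. Its stops remain stops, since mc ζ ≤ W j ≤ mc (Y j);
    -- steps through values below β remain steps by f; steps through values from β on become stops
    -- by g.
    sub-Y : ∀ {j} → suc b ≤ j → t ≤ mc ξ →
      (∀ {s} → 0 < s → s ≤ t → Φ (L.nfo s) ≺ β → Φ (L.nfo s) ≺ Y j) →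
      (∀ {s} → 0 < s → s ≤ t → β ≼ Φ (L.nfo s) → Φ (L.nfo s) ≺ β+b → φ s ≤ U.W β j) →
      U.Sub (Y j) (mc (Y j)) (φ t)
    sub-Y {t} {j} b<j t≤c f g = go (<-wellFounded t) ≤-refl
      where
      go : ∀ {s} → Acc _<_ s → s ≤ t → U.Sub (Y j) (mc (Y j)) (φ s)
      go {zero} _ _ = U.stop (subst (_≤ mc (Y j)) (sym φ0) z≤n)
      go {suc s} (acc r) p with USub-unfold (s≤s z≤n) (≤-trans p t≤c) (subζ (≤-trans p t≤c))
      ... | inj₁ q = U.stop (≤-trans q (≤-trans (mcζ≤W b<j) (W≤mcY j)))
      ... | inj₂ (q , _) with ≼-or-≻ β (Φ (L.nfo (suc s)))
      ...   | inj₁ q' = U.stop (≤-trans (g (s≤s z≤n) p q' q) (W≤mcY j))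
      ...   | inj₂ q' = USub-step (s≤s z≤n) (≤-trans p t≤c) (f (s≤s z≤n) p q')
                          (go (r (L.mc-nfo-< s)) (≤-trans (<⇒≤ (L.mc-nfo-< s)) p))

    -- (b+1)(k+1) - 1 for k = `L.k`, one less than the index at which `U.W` gives 𝔸(β + b); so Y j*
    -- is the last ordinal visited.
    j* : ℕ
    j* = L.k + b * U.k

    val-ζ : U.val β+b ≡ U.val (Y j*)
    val-ζ = U.val-lim limβ nβ b

    b<j* : suc b ≤ j*
    b<j* = s≤s (≤-trans (m≤m*n b U.k) (m≤n+m (b * U.k) (suc κ)))

    finish : Φ ξ ≺ Y j* → U.Sub (Y j*) (mc (Y j*)) (φ (mc ξ)) → U.val (Φ ξ) < U.val β+b
    finish p q = subst (U.val (Φ ξ) <_) (sym val-ζ) (IH (nY j*) (Y≺ζ j*) p q)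

    val-above : ∀ {τ} → Nf τ → β ≼ Φ τ → Φ τ ≺ β+b → U.val (Φ τ) ≤ U.W β (b * U.k)
    val-above nτ p q with ≺-addFin⇒ (Φ-Nf nτ) (ll limβ) p q
    ... | b₀ , b₀<b , r = subst (_≤ U.W β (b * U.k)) (sym (trans (cong U.val r) (U.val-lim limβ nβ b₀)))
                            (U.W-mono-≤ limβ nβ (*-monoˡ-≤ U.k b₀<b))

    φ-above : 0 < t → t ≤ mc ξ → β ≼ Φ (L.nfo t) → Φ (L.nfo t) ≺ β+b → φ t ≤ U.W β (b * U.k)
    φ-above {t} p q r s = subst (_≤ U.W β (b * U.k)) (proj₂ (good p q)) (val-above (L.nfo-Nf t) r s)

    case-above : β ≼ Φ ξ → U.val (Φ ξ) < U.val β+b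
    case-above p with ≺-addFin⇒ (Φ-Nf nξ) (ll limβ) p Φξ≺
    ... | b₀ , b₀<b , r = subst (λ s → U.val s < U.val β+b) (sym r) (U.val-addFin-< (ll limβ) nβ b₀<b)

    case-gap : Gap β → Φ ξ ≺ β → U.val (Φ ξ) < U.val β+b
    case-gap g p = finish (g nξ p mcβ<) (sub-Y b<j* ≤-refl (λ {s} _ _ q → g (L.nfo-Nf s) q mcβ<)
      λ q r u w → ≤-trans (φ-above q r u w) (U.W-mono-≤ limβ nβ (m≤n+m (b * U.k) L.k)))
      where
      mcβ< : mc β < U.W β j*
      mcβ< = ≤-trans (≤-trans (≤-reflexive (+-comm 1 (mc β))) (+-monoʳ-≤ (mc β) {1} {j*} (s≤s z≤n))) (U.W-growth limβ nβ j*)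

    -- Domination of the iteration at the smaller base

    module ExactCase (α : Ord) (E : Exact β α) (a : ℕ) (b≤φa : b ≤ φ a) (a-least : ∀ {z} → z < a → φ z < b) where

      open Exact E renaming (nf to nα; lim to limα)

      a≤b : a ≤ b
      a≤b = ≮⇒≥ λ p → <⇒≱ (a-least p) (≤φ b)

      <a : φ z < b → z < a
      <a {z} p = ≰⇒> λ q → <⇒≱ p (≤-trans b≤φa (φ-≤ q))

      above-form : ∀ {τ} → Nf τ → β ≼ Φ τ → Φ τ ≺ β+b → ∃ λ z → τ ≡ addFin α z × φ z < b
      above-form {τ} nτ p q with ≺-addFin⇒ (Φ-Nf nτ) (ll limβ) p q
      ... | b₀ , b₀<b , r = go (toView nτ) r
        where
        go : ∀ {τ} → View τ → Φ τ ≡ addFin β b₀ → ∃ λ z → τ ≡ addFin α z × φ z < b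
        go (view {α₀} l₀ n₀ z) r with addFin-injective (Φ-LZ l₀) (ll limβ) (trans (sym (Φ-addFin α₀ z)) r)
        ... | s , refl = z , cong (λ x → addFin x z) (Exact-preimage E n₀ s) , b₀<b

      -- The counterpart of β + b at the smaller base. From b ≤ φ(a), every τ with Φ τ < β + b lies
      -- below α + a; minimality of a keeps the iteration for α + a short enough to be dominated.
      χ : Ord
      χ = addFin α a

      nχ : Nf χ
      nχ = addFin-Nf (ll limα) nα a

      ≺ζ⇒≺χ : ∀ {τ} → Nf τ → Φ τ ≺ β+b → τ ≺ χ
      ≺ζ⇒≺χ {τ} nτ p with ≼-or-≻ β (Φ τ)
      ... | inj₂ q = ≺-≼-trans (above nτ q) (≼-addFin α a)
      ... | inj₁ q with above-form nτ q p
      ...   | z , refl , r = addFin-≺ α (<a r)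

      sub-χ : t ≤ mc ξ → L.Sub χ (mc χ) t
      sub-χ {t} p = go (<-wellFounded t) p
        where
        ≤mcχ : ∀ {t} → φ t ≤ mc β+b → t ≤ mc χ
        ≤mcχ {t} p rewrite mcζ | mc-addFin α a with ≤⊔⁻ (mc β) b p
        ... | inj₁ q = ≤-trans (≤mc q) (m≤m⊔n (mc α) a)
        ... | inj₂ q = ≤-trans (φ-≤⁻ (≤-trans q b≤φa)) (m≤n⊔m (mc α) a)
        go : ∀ {t} → Acc _<_ t → t ≤ mc ξ → L.Sub χ (mc χ) t
        go {zero} _ _ = L.stop z≤n
        go {suc t} (acc r) p with USub-unfold (s≤s z≤n) p (subζ p)
        ... | inj₁ q = L.stop (≤mcχ q)
        ... | inj₂ (q , _) = L.step (≺ζ⇒≺χ (L.nfo-Nf (suc t)) q)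
                               (go (r (L.mc-nfo-< t)) (≤-trans (<⇒≤ (L.mc-nfo-< t)) p))

      -- The pulled-back derivation for mc ξ, extended by one step through ξ itself, is a derivation
      -- for 𝔸(ξ), to which `Sub⇒<` applies.
      val-ξ<χ : L.val ξ < L.val χ
      val-ξ<χ = L.Sub⇒< nχ (L.Sub-step (≤-trans (s≤s z≤n) (L.mc<val nξ))
        (subst (_≺ χ) (sym (L.nfo-unique Nξ)) (≺ζ⇒≺χ nξ Φξ≺))
        (subst (L.Sub χ (mc χ)) (cong mc (sym (L.nfo-unique Nξ))) (sub-χ ≤-refl)))

      -- i steps of the iteration over α at base k are dominated by j steps over
      -- β at base k+1. The second clause lets φ jump: between 𝔸(α+z) and 𝔸(β+φ(z)).
      Adm : ℕ → ℕ → Set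
      Adm i j = suc (b + i) ≤ j × (∀ {z} → φ z < b → suc (φ z) * U.k + i ≤ j + suc z * L.k)

      Adm-pred : Adm (suc i) (suc j) → Adm i j
      Adm-pred {i} {j} (p , q) = ≤-pred (subst (λ s → suc s ≤ suc j) (+-suc b i) p) ,
        λ {z} r → ≤-pred (subst (_≤ suc (j + suc z * L.k)) (+-suc (suc (φ z) * U.k) i) (q r))

      -- Mutual induction on i. If Y j ≤ Φ τ < β, then `approx` with `dominate i j` puts τ at or
      -- above α[W i], so 𝔸(τ) reaches the next iterate (`beneath`). Thus `sub-Y` applies to numbers
      -- below that iterate (`sub-Yj`), and `Sub⇒<` gives `dominate` at i + 1, j + 1.
      dominate : ∀ i j → Adm i j → t ≤ mc ξ → t < L.W α i → φ t < U.W β j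
      sub-Yj : ∀ i j → Adm i j → t ≤ mc ξ → t < L.W α (suc i) → U.Sub (Y j) (mc (Y j)) (φ t)
      beneath : ∀ {i j} → Adm i j → ∀ {τ} → Nf τ → mc τ ≤ mc ξ → L.val τ < L.W α (suc i) → Φ τ ≺ β → Φ τ ≺ Y j

      dominate zero j (p , _) _ q = ≤-<-trans (<mc q)
        (≤-trans (≤-trans (≤-reflexive (+-comm 1 (mc β))) (+-monoʳ-≤ (mc β) (≤-trans (s≤s z≤n) p))) (U.W-growth limβ nβ j))
      dominate (suc i) zero (() , _)
      dominate (suc i) (suc j) A p q = U.Sub⇒< (nY j) (sub-Yj i j (Adm-pred A) p q)

      beneath {i} {j} A {τ} nτ p q r with ≼-or-≻ (Y j) (Φ τ)
      ... | inj₂ s = s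
      ... | inj₁ s = ⊥-elim (<⇒≱ q (L.val-fs-≤ limα nα (L.W-pos limα nα i) nτ
              (approx nτ (L.W-pos limα nα i) (U.W-pos limβ nβ j)
                (λ {u} u≤ w≤ → ≮⇒≥ λ u< → <⇒≱ (dominate i j A (≤-trans u≤ p) u<) w≤) s r)
              (above nτ r)))

      sub-Yj {t} i j A t≤c t< = sub-Y (≤-trans (s≤s (m≤m+n b i)) (proj₁ A)) t≤c
        (λ {s} 0<s s≤t p → beneath A (L.nfo-Nf s)
          (≤-trans (<⇒≤ (L.mc-nfo 0<s)) (≤-trans s≤t t≤c))
          (subst (_< L.W α (suc i)) (sym (L.nfo-val 0<s)) (≤-<-trans s≤t t<)) p)
        stops
        where
        stops : ∀ {s} → 0 < s → s ≤ t → β ≼ Φ (L.nfo s) → Φ (L.nfo s) ≺ β+b → φ s ≤ U.W β j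
        stops {s} 0<s s≤t p q with above-form (L.nfo-Nf s) p q
        ... | z , r , φz<b = begin
          φ s                              ≡⟨ sym (proj₂ (good 0<s (≤-trans s≤t t≤c))) ⟩
          U.val (Φ (L.nfo s))              ≡⟨ cong (λ y → U.val (Φ y)) r ⟩
          U.val (Φ (addFin α z))           ≡⟨ cong U.val Φαz ⟩
          U.val (addFin β (φ z))           ≡⟨ U.val-lim limβ nβ (φ z) ⟩
          U.W β (suc (φ z) * U.k)          ≤⟨ U.W-mono-≤ limβ nβ steps ⟩
          U.W β j                          ∎
          where
          open ≤-Reasoning
          Φα : Φ α ≡ β
          Φα with ≺-addFin⇒ (Φ-Nf (L.nfo-Nf s)) (ll limβ) p q
          ... | b₀ , _ , eq' = proj₁ (addFin-injective (ll (Φ-Lim limα)) (ll limβ)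
                 (trans (sym (Φ-addFin α z)) (trans (cong Φ (sym r)) eq')))
          Φαz : Φ (addFin α z) ≡ addFin β (φ z)
          Φαz = trans (Φ-addFin α z) (cong (λ y → addFin y (φ z)) Φα)
          s≡ : s ≡ L.W α (suc z * L.k)
          s≡ = trans (sym (L.nfo-val 0<s)) (trans (cong L.val r) (L.val-lim limα nα z))
          -- The number s = 𝔸(α + z) is itself an iterate over α and lies below the one of index i +
          -- 1, so its index is at most i.
          z≤i : suc z * L.k ≤ i
          z≤i = ≮⇒≥ λ i< → <⇒≱ (≤-<-trans s≤t t<) (≤-trans (L.W-mono-≤ limα nα i<) (≤-reflexive (sym s≡)))
          steps : suc (φ z) * U.k ≤ j
          steps = +-cancelʳ-≤ i _ j (≤-trans (proj₂ A φz<b) (+-monoʳ-≤ j z≤i))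

      -- (a+1)k - 1, the index matching j* for χ = α + a.
      i* : ℕ
      i* = suc κ + a * L.k

      φ-+ : ∀ z d → φ z + d ≤ φ (z + d)
      φ-+ z zero = ≤-reflexive (trans (+-identityʳ (φ z)) (cong φ (sym (+-identityʳ z))))
      φ-+ z (suc d) = ≤-trans (≤-reflexive (+-suc (φ z) d)) (≤-<-trans (φ-+ z d) (φ-< (+-monoʳ-< z ≤-refl)))

      Adm* : Adm i* j*
      Adm* = first , second
        where
        open +-*-Solver
        first : suc (b + i*) ≤ j*
        first = ≤-trans (s≤s (+-monoʳ-≤ b (+-monoʳ-≤ (suc κ) (*-monoˡ-≤ L.k a≤b))))
          (≤-reflexive (solve 2 (λ κ b → con 1 :+ (b :+ (con 1 :+ κ :+ b :* (con 2 :+ κ))) :=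
            con 2 :+ κ :+ b :* (con 3 :+ κ)) refl κ b))
        second : ∀ {z} → φ z < b → suc (φ z) * U.k + i* ≤ j* + suc z * L.k
        second {z} φz<b = subst₂ (λ a b → suc (φ z) * U.k + (suc κ + a * L.k) ≤ L.k + b * U.k + suc z * L.k)
            -- With a = z + 1 + d and b = φ(z) + (d + 1) + g, the two sides differ by exactly 1 + d
            -- + g(k+1).
            a≡ b≡ (≤-trans (m≤m+n _ (1 + d + g * U.k)) (≤-reflexive (solve 5
              (λ κ z q d e → (con 1 :+ q) :* (con 3 :+ κ) :+ (con 1 :+ κ :+ (con 1 :+ z :+ d) :* (con 2 :+ κ))
                  :+ (con 1 :+ d :+ e :* (con 3 :+ κ)) :=
                con 2 :+ κ :+ (q :+ (con 1 :+ d) :+ e) :* (con 3 :+ κ) :+ (con 1 :+ z) :* (con 2 :+ κ))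
              refl κ z (φ z) d g)))
          where
          d : ℕ
          d = a ∸ suc z
          a≡ : suc z + d ≡ a
          a≡ = m+[n∸m]≡n (<a φz<b)
          ≤b : φ z + suc d ≤ b
          ≤b = ≤-trans (≤-reflexive (+-suc (φ z) d)) (≤-<-trans (φ-+ z d) (a-least (≤-reflexive a≡)))
          g : ℕ
          g = b ∸ (φ z + suc d)
          b≡ : φ z + suc d + g ≡ b
          b≡ = m+[n∸m]≡n ≤b

      val-χ : L.val χ ≡ L.W α (suc i*)
      val-χ = L.val-lim limα nα a

      case-exact : Φ ξ ≺ β → U.val (Φ ξ) < U.val β+b
      case-exact p = finish (beneath Adm* nξ ≤-refl ξ< p) (sub-Yj i* j* Adm* ≤-refl (<-trans (L.mc<val nξ) ξ<))
        where
        ξ< : L.val ξ < L.W α (suc i*)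
        ξ< = subst (L.val ξ <_) val-χ val-ξ<χ

    least : ∃ λ a → b ≤ φ a × (∀ {z} → z < a → φ z < b)
    least = go b (≤φ b)
      where
      go : ∀ s → b ≤ φ s → ∃ λ a → b ≤ φ a × (∀ {z} → z < a → φ z < b)
      go zero p = 0 , p , λ ()
      go (suc s) p with b ≤? φ s
      ... | yes q = go s q
      ... | no ¬q = suc s , p , λ { (s≤s r) → ≤-<-trans (φ-≤ r) (≰⇒> ¬q) }

    claim : U.val (Φ ξ) < U.val β+b
    claim with ≼-or-≻ β (Φ ξ) | dichotomy limβ nβ | least
    ... | inj₁ p | _ | _ = case-above p
    ... | inj₂ p | inj₁ g | _ = case-gap g p
    ... | inj₂ p | inj₂ (α , E) | a , q , r = ExactCase.case-exact α E a q r p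

  claim : Nf ζ → Claim ζ
  claim nζ = go (Nf⇒Acc nζ) (toView nζ)
    where
    go : ∀ {ζ} → Acc _⊏_ ζ → View ζ → Claim ζ
    go _ (view lz _ b) p _ with ≺-addFin⇒ (Φ-Nf nξ) lz (𝟎≼ (Φ ξ)) p
    ... | b₀ , b₀<b , r = subst (λ s → U.val s < U.val (addFin 𝟎 b)) (sym r) (U.val-addFin-< lz nf0 b₀<b)
    go (acc r) (view {β} (ll l) n b) p s =
      Limit.claim β l n b (λ ny q → go (r (ny , q)) (toView ny)) p s

  -- By `≻⇒NFO` it suffices to exclude a normal form ζ above Φ ξ with mc (Φ ξ) < 𝔸(ζ) ≤ 𝔸(Φ ξ). For
  -- normal forms `<⇒Sub` supplies the hypothesis of `claim`.
  preserve : U.NFO (Φ ξ)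
  preserve = U.≻⇒NFO (Φ-Nf nξ) λ {ζ} p q r → ≮⇒≥ λ s →
    <⇒≱ (claim (U.Ch-Nf p) q (U.<⇒Sub p (subst (_< U.val ζ) (Φ-mc ξ) s))) r

-- The base change function

mapC-cong : ∀ {f g} x → (∀ {s} → s ≤ mc x → f s ≡ g s) → mapC f x ≡ mapC g x
mapC-cong 𝟎 p = refl
mapC-cong {f} {g} (cnf a b c) p
  rewrite mapC-cong {f} {g} a (λ s → p (≤-trans s (mc-exp a b c)))
        | mapC-cong {f} {g} c (λ s → p (≤-trans s (mc-tail a b c)))
        | p (mc-coef a b c) = refl

plusTerm-Nf : Nf (cnf a b c) → plusTerm a b c ≡ cnf a b c
plusTerm-Nf (nfc p nf0 r) = refl
plusTerm-Nf (nfc p (nfc _ _ _) (◂c r)) rewrite ≺⇒gt r = refl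

-- Agreement with the relational definition of normal forms

module _ (κ : ℕ) where

  open NormalForm κ

  Maximal⇒IsMax : Nf ξ → Maximal m (val ξ) ζ → IsMax k m ξ ζ
  Maximal⇒IsMax {ξ} {m} {ζ} nξ ((nζ , p , q) , f) =
    (Nf⇒NF nζ , (val ζ , val-A nζ , p) , (val ξ , val-A nξ , q)) ,
    λ { x (nx , (v , av , v≤) , (u , au , u≤)) → ≼⇒≤ₒ (f
        ( NF⇒Nf nx , subst (_≤ m) (A-det av (val-A (NF⇒Nf nx))) v≤
        , subst (_≤ mc x) (A-det au (val-A nξ)) u≤)) }

  Ch⇒Star : Ch m ξ → Star (Next k m) 𝟎 ξ
  Ch⇒Star (c0 _) = ε
  Ch⇒Star (cs ch _ M) = Ch⇒Star ch ◅◅ (next-max (Maximal⇒IsMax (Ch-Nf ch) M) ◅ ε)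

  nfo-KNF : 0 < m → KNF k m (nfo m)
  nfo-KNF {m} p = Nf⇒NF (nfo-Nf m) , subst (A k (nfo m)) (nfo-val p) (val-A (nfo-Nf m)) , Ch⇒Star (nfo-Ch p)

module BaseChange (κ : ℕ) where

  module L = NormalForm κ
  module U = NormalForm (suc κ)

  -- The fuel replaces recursion on mc (`nfo` t) < t; fuel t + 1 suffices for t, so the default 0 is
  -- never reached from `up` at positive numbers.
  upTo-fuel : ℕ → ℕ → ℕ
  upTo-fuel zero _ = 0
  upTo-fuel (suc n) zero = 0
  upTo-fuel (suc n) (suc t) = U.val (mapC (upTo-fuel n) (L.nfo (suc t)))

  up : ℕ → ℕ
  up t = upTo-fuel (suc t) t

  fuel-irrelevant : ∀ m n t → t < m → t < n → upTo-fuel m t ≡ upTo-fuel n t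
  fuel-irrelevant (suc m) (suc n) zero _ _ = refl
  fuel-irrelevant (suc m) (suc n) (suc t) (s≤s p) (s≤s q) = cong U.val (mapC-cong (L.nfo (suc t)) λ {s} r →
    fuel-irrelevant m n s (≤-trans (s≤s (≤-pred (≤-<-trans r (L.mc-nfo-< t)))) p)
                          (≤-trans (s≤s (≤-pred (≤-<-trans r (L.mc-nfo-< t)))) q))

  upO : Ord → Ord
  upO = mapC up

  up-val : 0 < t → up t ≡ U.val (upO (L.nfo t))
  up-val {suc t} _ = cong U.val (mapC-cong (L.nfo (suc t)) λ {s} r →
    fuel-irrelevant (suc t) (suc s) s (≤-<-trans r (L.mc-nfo-< t)) ≤-refl)

  up-1 : up 1 ≡ 1
  up-1 = trans (up-val (s≤s z≤n)) (trans (cong (λ x → U.val (upO x)) nfo-1) U.val-𝟎)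
    where
    nfo-1 : L.nfo 1 ≡ 𝟎
    nfo-1 = trans (cong L.nfo (sym L.val-𝟎)) (L.nfo-unique {𝟎} (L.c0 (subst (0 <_) (sym L.val-𝟎) (s≤s z≤n))))

  Inv : ℕ → Set
  Inv m = (0 < m → U.NFO (upO (L.nfo m))) × (∀ {s} → s < m → up s < up m)

  module Extend (m : ℕ) (IH : ∀ {t} → t < suc m → Inv t) where

    -- At this stage up is only known to be increasing on [0, m].
    φ : ℕ → ℕ
    φ t with t ≤? m
    ... | yes _ = up t
    -- Adding `up m` puts these values above those on [0, m], and for m = 0 it still gives φ 1 = 1.
    ... | no _ = up m + t

    φ-up : t ≤ m → φ t ≡ up t
    φ-up {t} p with t ≤? m
    ... | yes _ = refl
    ... | no ¬p = ⊥-elim (¬p p)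

    up-≤ : ∀ {s} → s ≤ m → up s ≤ up m
    up-≤ p with m≤n⇒m<n∨m≡n p
    ... | inj₁ q = <⇒≤ (proj₂ (IH ≤-refl) q)
    ... | inj₂ refl = ≤-refl

    φ-< : ∀ {s t} → s < t → φ s < φ t
    φ-< {s} {t} p with s ≤? m | t ≤? m
    ... | yes _ | yes q = proj₂ (IH (s≤s q)) p
    ... | yes q | no _ = <-≤-trans (s≤s (up-≤ q)) (≤-trans (≤-reflexive (+-comm 1 (up m))) (+-monoʳ-≤ (up m) (≤-trans (s≤s z≤n) p)))
    ... | no ¬q | yes q = ⊥-elim (¬q (≤-trans (<⇒≤ p) q))
    ... | no _ | no _ = +-monoʳ-< (up m) p

    φ0 : φ 0 ≡ 0
    φ0 = φ-up z≤n

    φ1 : φ 1 ≡ 1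
    φ1 with 1 ≤? m
    ... | yes _ = up-1
    ... | no ¬p with refl ← n<1⇒n≡0 (≰⇒> ¬p) = refl

    open CoefChange φ φ0 φ1 (λ {s} {t} → φ-< {s} {t})

    Φ≡upO : ∀ x → mc x ≤ m → Φ x ≡ upO x
    Φ≡upO x p = mapC-cong x λ q → φ-up (≤-trans q p)

    Φ≡upO-nfo : 0 < t → t ≤ suc m → Φ (L.nfo t) ≡ upO (L.nfo t)
    Φ≡upO-nfo p q = Φ≡upO _ (≤-pred (<-≤-trans (L.mc-nfo p) q))

    val-Φ : 0 < t → t ≤ suc m → U.val (Φ (L.nfo t)) ≡ up t
    val-Φ p q = trans (cong U.val (Φ≡upO-nfo p q)) (sym (up-val p))

    χ : Ord
    χ = L.nfo (suc m)

    NFO-Φ : 0 < t → t ≤ m → U.NFO (Φ (L.nfo t))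
    NFO-Φ p q = subst U.NFO (sym (Φ≡upO-nfo p (m≤n⇒m≤1+n q))) (proj₁ (IH (s≤s q)) p)

    NFO-Φχ : U.NFO (Φ χ)
    NFO-Φχ = Preservation.preserve κ φ φ0 φ1 (λ {s} {t} → φ-< {s} {t}) χ (L.nfo-NFO (s≤s z≤n)) λ p q →
      let r = ≤-trans q (≤-pred (L.mc-nfo-< m)) in
      NFO-Φ p r , trans (val-Φ p (m≤n⇒m≤1+n r)) (sym (φ-up r))

    -- Compare the normal forms of s and m + 1. If that of s is above χ, then s ≤ mc χ by `NFO-≻`.
    -- If it is below, the images are ordered normal forms, and `NFO-≻` at the larger base reduces a
    -- failure to one at the maximal coefficient of s.
    up-< : ∀ {s} → s < suc m → up s < up (suc m)
    up-< {s} = go (<-wellFounded s)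
      where
      val-Φχ : U.val (Φ χ) ≡ up (suc m)
      val-Φχ = val-Φ (s≤s z≤n) ≤-refl
      mcΦχ : φ (mc χ) < up (suc m)
      mcΦχ = subst₂ _<_ (Φ-mc χ) val-Φχ (U.mc<val (U.Ch-Nf NFO-Φχ))
      go : ∀ {s} → Acc _<_ s → s < suc m → up s < up (suc m)
      go {zero} _ _ = ≤-<-trans z≤n mcΦχ
      go {suc s} (acc r) p with tri (L.nfo (suc s)) χ
      ... | tri≡ q = ⊥-elim (<⇒≢ p (trans (sym (L.nfo-val (s≤s z≤n))) (trans (cong L.val q) (L.nfo-val (s≤s z≤n)))))
      ... | tri≻ q = subst (_< up (suc m)) (φ-up (≤-pred p)) (≤-<-trans (φ-≤ (subst (_≤ mc χ) (L.nfo-val (s≤s z≤n))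
              (L.NFO-≻ (L.nfo-NFO (s≤s z≤n)) (L.nfo-NFO (s≤s z≤n)) q
                (subst₂ _≤_ (sym (L.nfo-val (s≤s z≤n))) (sym (L.nfo-val (s≤s z≤n))) (<⇒≤ p))))) mcΦχ)
      ... | tri≺ q = ≰⇒> λ up≤ → <⇒≱ (go (r (L.mc-nfo-< s)) (<-trans (L.mc-nfo-< s) p)) (begin
          up (suc m)                     ≡⟨ sym val-Φχ ⟩
          U.val (Φ χ)                    ≤⟨ U.NFO-≻ (NFO-Φ (s≤s z≤n) (≤-pred p)) NFO-Φχ (Φ-≺ q)
                                              (subst₂ _≤_ (sym val-Φχ) (sym (val-Φ (s≤s z≤n) (<⇒≤ p))) up≤) ⟩
          mc (Φ (L.nfo (suc s)))         ≡⟨ Φ-mc (L.nfo (suc s)) ⟩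
          φ (mc (L.nfo (suc s)))         ≡⟨ φ-up (≤-trans (≤-pred (L.mc-nfo-< s)) (<⇒≤ (≤-pred p))) ⟩
          up (mc (L.nfo (suc s)))        ∎)
        where open ≤-Reasoning

    inv : Inv (suc m)
    inv = (λ _ → subst U.NFO (Φ≡upO-nfo (s≤s z≤n) ≤-refl) NFO-Φχ) , up-<

  inv : ∀ m → Inv m
  inv m = go (<-wellFounded m)
    where
    go : ∀ {m} → Acc _<_ m → Inv m
    go {zero} _ = (λ ()) , λ ()
    go {suc m} (acc r) = Extend.inv m λ p → go (r p)

  up-mono : ∀ {s t} → s < t → up s < up t
  up-mono {s} {t} = proj₂ (inv t)

  open CoefChange up refl up-1 (λ {s} {t} → up-mono {s} {t}) public
    using () renaming (Φ-mc to upO-mc; Φ-Nf to upO-Nf; φ-pos to up-pos)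

  upO-nfo : 0 < t → U.nfo (up t) ≡ upO (L.nfo t)
  upO-nfo {t} p = trans (cong U.nfo (up-val p)) (U.nfo-unique (proj₁ (inv t) p))

  up-UpN : ∀ t → UpN L.k U.k t (up t)
  up-UpN t = go (<-wellFounded t)
    where
    go : ∀ {t} → Acc _<_ t → UpN L.k U.k t (up t)
    goO : ∀ {t x} → (∀ {s} → s < t → UpN L.k U.k s (up s)) → Nf x → mc x < t → UpO L.k U.k x (upO x)
    go {zero} _ = upN-zero
    go {suc t} (acc r) = upN-suc (nfo-KNF κ (s≤s z≤n))
      (goO (λ p → go (r p)) (L.nfo-Nf (suc t)) (L.mc-nfo-< t))
      (subst (A U.k (upO (L.nfo (suc t)))) (sym (up-val (s≤s z≤n))) (U.val-A (upO-Nf (L.nfo-Nf (suc t)))))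
    goO f nf0 p = upO-zero
    goO f n@(nfc {a} {c} {b} na nc r) p = subst (UpO L.k U.k (cnf a (suc b) c)) (plusTerm-Nf (upO-Nf n))
      (upO-cnf (goO f na (≤-<-trans (mc-exp a (suc b) c) p)) (f (≤-<-trans (mc-coef a (suc b) c) p))
               (goO f nc (≤-<-trans (mc-tail a (suc b) c) p)))

-- Termination

open NormalForm using (nfo; nfo-Nf; nfo-NFO; nfo-val; mc-nfo-<; NFO-≻)
open BaseChange using (up; upO; upO-mc; upO-Nf; upO-nfo; up-pos; up-UpN)

variable
  κ ι μ : ℕ

-- Iterated base change from base κ + 2 to base ι + 2.
data Lift (κ m : ℕ) : ℕ → ℕ → Set where
  lift-refl : Lift κ m κ m
  lift-up : Lift κ m ι n → Lift κ m (suc ι) (up ι n)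

data LiftO (κ : ℕ) (ξ : Ord) : ℕ → Ord → Set where
  lift-refl : LiftO κ ξ κ ξ
  lift-up : LiftO κ ξ ι ζ → LiftO κ ξ (suc ι) (upO ι ζ)

Lift-trans : Lift κ m ι n → Lift ι n μ t → Lift κ m μ t
Lift-trans p lift-refl = p
Lift-trans p (lift-up q) = lift-up (Lift-trans p q)

LiftO-trans : LiftO κ x ι y → LiftO ι y μ ξ → LiftO κ x μ ξ
LiftO-trans p lift-refl = p
LiftO-trans p (lift-up q) = lift-up (LiftO-trans p q)

LiftO-mc : LiftO κ ξ ι ζ → Lift κ (mc ξ) ι (mc ζ)
LiftO-mc lift-refl = lift-refl
LiftO-mc {ξ = ξ} (lift-up {ι} {ζ} p) = subst (Lift _ _ (suc ι)) (sym (upO-mc ι ζ)) (lift-up (LiftO-mc p))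

Lift-nfo : 0 < m → Lift κ m ι n → 0 < n × LiftO κ (nfo κ m) ι (nfo ι n)
Lift-nfo p lift-refl = p , lift-refl
Lift-nfo p (lift-up {ι} q) with Lift-nfo p q
... | r , s = up-pos ι r , subst (LiftO _ _ (suc ι)) (sym (upO-nfo ι r)) (lift-up s)

Lift-0 : Lift κ 0 ι n → n ≡ 0
Lift-0 lift-refl = refl
Lift-0 (lift-up p) with refl ← Lift-0 p = refl

data LiftCnf (κ : ℕ) (a : Ord) (b : ℕ) (c : Ord) (ι : ℕ) : Ord → Set where
  lift-cnf : LiftO κ a ι a' → Lift κ b ι b' → LiftO κ c ι c' → LiftCnf κ a b c ι (cnf a' b' c')

LiftO-cnf : LiftO κ (cnf a b c) ι ξ → LiftCnf κ a b c ι ξ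
LiftO-cnf lift-refl = lift-cnf lift-refl lift-refl lift-refl
LiftO-cnf (lift-up p) with LiftO-cnf p
... | lift-cnf q r s = lift-cnf (lift-up q) (lift-up r) (lift-up s)

LiftO-𝟎 : LiftO κ 𝟎 ι ξ → ξ ≡ 𝟎
LiftO-𝟎 lift-refl = refl
LiftO-𝟎 (lift-up p) with refl ← LiftO-𝟎 p = refl

-- Accessibility of numbers written in base κ + 2, where p at a later base ι + 2
-- is below m when it is below the base change of m. These are the ordinals
-- m^{↑ω} below ε_{Ω+1}, ordered without a notation system for them.
data AccN (κ m : ℕ) : Set where
  accN : (∀ {ι n p} → Lift κ m ι n → p < n → AccN ι p) → AccN κ m

-- The corresponding notion for ordinals all of whose coefficients are accessible.
data AccO (κ : ℕ) (ξ : Ord) : Set where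
  accO : (∀ {ι ζ x} → LiftO κ ξ ι ζ → Nf x → AccN ι (mc x) → x ≺ ζ → AccO ι x) → AccO κ ξ

AccN-0 : AccN κ 0
AccN-0 = accN λ p q → ⊥-elim (<⇒≱ q (subst (_≤ _) (sym (Lift-0 p)) z≤n))

AccO-𝟎 : AccO κ 𝟎
AccO-𝟎 = accO λ p _ _ q → ⊥-elim (≺⇒⋡ (subst (_ ≺_) (LiftO-𝟎 p) q) (𝟎≼ _))

AccN-≤ : AccN κ m → n ≤ m → AccN κ n
AccN-≤ (accN r) p with m≤n⇒m<n∨m≡n p
... | inj₁ q = r lift-refl q
... | inj₂ refl = accN r

AccN-lift : AccN κ m → Lift κ m ι n → AccN ι n
AccN-lift (accN r) p = accN λ q → r (Lift-trans p q)

-- The scheme of `acc-cnf`. Accessibility proofs stay at their original bases, with lifts to the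
-- current base t alongside, so that the recursion remains structural.
AccO-cnf : AccO κ a → LiftO κ a t a' → AccN ι b → Lift ι b t b' → AccO μ c → LiftO μ c t c' → AccO t (cnf a' b' c')
AccO-below-cnf : AccO κ a → LiftO κ a t a' → AccN ι b → Lift ι b t b' → AccO μ c → LiftO μ c t c' →
  Nf x → AccN t (mc x) → x ≺ cnf a' b' c' → AccO t x
AccO-◂ : AccO κ a → LiftO κ a t a' → Nf x → AccN t (mc x) → x ◂ a' → AccO t x

AccO-cnf {t = t} A p B q C r = accO λ s → below (LiftO-cnf s)
  where
  below : ∀ {u ζ x} → LiftCnf t _ _ _ u ζ → Nf x → AccN u (mc x) → x ≺ ζ → AccO u x
  below (lift-cnf p' q' r') = AccO-below-cnf A (LiftO-trans p p') B (Lift-trans q q') C (LiftO-trans r r')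

AccO-below-cnf A p B q C r _ _ ≺𝟎 = AccO-𝟎
AccO-below-cnf (accO f) p B q C r (nfc {a} {c} {b} na nc s) m (≺e l) =
  AccO-cnf (f p na (AccN-≤ m (mc-exp a (suc b) c)) l) lift-refl (AccN-≤ m (mc-coef a (suc b) c)) lift-refl
    (AccO-◂ (f p na (AccN-≤ m (mc-exp a (suc b) c)) l) lift-refl nc (AccN-≤ m (mc-tail a (suc b) c)) s) lift-refl
AccO-below-cnf A p (accN f) q C r (nfc {a} {c} {b} na nc s) m (≺n l) =
  AccO-cnf A p (f q l) lift-refl (AccO-◂ A p nc (AccN-≤ m (mc-tail a (suc b) c)) s) lift-refl
AccO-below-cnf A p B q (accO f) r (nfc {a} {c} {b} na nc s) m (≺t l) =
  AccO-cnf A p B q (f r nc (AccN-≤ m (mc-tail a (suc b) c)) l) lift-refl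

AccO-◂ A p nf0 _ _ = AccO-𝟎
AccO-◂ (accO f) p (nfc {a} {c} {b} na nc s) m (◂c l) =
  AccO-cnf (f p na (AccN-≤ m (mc-exp a (suc b) c)) l) lift-refl (AccN-≤ m (mc-coef a (suc b) c)) lift-refl
    (AccO-◂ (f p na (AccN-≤ m (mc-exp a (suc b) c)) l) lift-refl nc (AccN-≤ m (mc-tail a (suc b) c)) s) lift-refl

Nf⇒AccO : Nf ξ → AccN κ (mc ξ) → AccO κ ξ
Nf⇒AccO nf0 _ = AccO-𝟎
Nf⇒AccO (nfc {a} {c} {b} na nc r) m = AccO-cnf
  (Nf⇒AccO na (AccN-≤ m (mc-exp a (suc b) c))) lift-refl (AccN-≤ m (mc-coef a (suc b) c)) lift-refl
  (Nf⇒AccO nc (AccN-≤ m (mc-tail a (suc b) c))) lift-refl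

Progress : ℕ → Ord → Set
Progress κ ξ = ∀ {ι n t} → LiftO κ ξ ι (nfo ι n) → AccN ι (mc (nfo ι t)) → 0 < t → nfo ι t ≺ nfo ι n → AccN ι t

-- If the normal form of t is below that of n, its maximal coefficient is accessible by induction on
-- t and `Progress` applies. If it is above, `NFO-≻` bounds t by mc (`nfo` n), a lift of the
-- accessible number mc ξ.
AccN-below : Progress κ ξ → AccN κ (mc ξ) → LiftO κ ξ ι (nfo ι n) → 0 < n → Acc _<_ t → t < n → AccN ι t
AccN-below {t = zero} f B p q r s = AccN-0
AccN-below {ι = ι} {n = n} {t = suc t} f B p q (acc r) s with tri (nfo ι (suc t)) (nfo ι n)
... | tri≺ l = f p (AccN-below f B p q (r (mc-nfo-< ι t)) (<-trans (mc-nfo-< ι t) s)) (s≤s z≤n) l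
... | tri≡ l = ⊥-elim (<⇒≢ s (trans (sym (nfo-val ι (s≤s z≤n))) (trans (cong (NormalForm.val ι) l) (nfo-val ι q))))
... | tri≻ l = AccN-≤ (AccN-lift B (LiftO-mc p)) (subst (_≤ mc (nfo ι n)) (nfo-val ι (s≤s z≤n))
        (NFO-≻ ι (nfo-NFO ι q) (nfo-NFO ι (s≤s z≤n)) l
          (subst₂ _≤_ (sym (nfo-val ι (s≤s z≤n))) (sym (nfo-val ι q)) (<⇒≤ s))))

AccO⇒AccN : AccO κ ξ → AccN κ (mc ξ) → 0 < m → ξ ≡ nfo κ m → AccN κ m
AccO⇒AccN (accO f) B p refl = accN λ q r → let 0<n , s = Lift-nfo p q in
  AccN-below (λ {ι} {_} {t} q C 0<t l → AccO⇒AccN (f q (nfo-Nf ι t) C l) C 0<t refl) B s 0<n (<-wellFounded _) r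

allAccN : ∀ κ m → AccN κ m
allAccN κ m = go (<-wellFounded m)
  where
  go : ∀ {m} → Acc _<_ m → AccN κ m
  go {zero} _ = AccN-0
  go {suc m} (acc r) = AccO⇒AccN (Nf⇒AccO (nfo-Nf κ (suc m)) B) B (s≤s z≤n) refl
    where
    B : AccN κ (mc (nfo κ (suc m)))
    B = go (r (mc-nfo-< κ m))

terminates : AccN i n → Goodstein m i n → ∃ λ j → Goodstein m j 0
terminates {i} {zero} _ g = i , g
terminates {i} {suc n} (accN f) g = terminates (f (lift-up lift-refl) pred<)
  -- Base i + 2 of the sequence is base 2 + i of `BaseChange`; subtracting 1 lands strictly below
  -- the lift of n + 1.
  (g-suc g (subst₂ (λ k l → UpN k l (suc n) (up i (suc n))) (+-comm 2 i) (+-comm 3 i) (up-UpN i (suc n))))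
  where
  pred< : up i (suc n) ∸ 1 < up i (suc n)
  pred< = ∸-monoʳ-< {up i (suc n)} {1} {0} (s≤s z≤n) (up-pos i {suc n} (s≤s z≤n))

theorem8p1 : (m : ℕ) → ∃ λ i → Goodstein m i 0
theorem8p1 m = terminates (allAccN 0 m) g-zero
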